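{- Let $r\geq 2$ be an integer, let $c=r^{ -(r+7)(r+1)}/2$, let $0<\alpha<r^{ -8}/8$, let $n\geq e^{2/c}$ be an integer, and let $G$ be a graph of order $n$ with exactly $\lceil (1-1/r-\alpha)n^2/2\rceil$ edges. Then at least one of the following holds: (i) $G$ contains a (not necessarily induced) subgraph isomorphic to $K_r^+\left(\lfloor c\ln n\rfloor,\ldots,\lfloor c\ln n\rfloor\right)$, with all $r$ parts of size $\lfloor c\ln n\rfloor$; (ii) $G$ contains an induced subgraph $G_0$ which is $r$-partite (i.e. $r$-colorable), has order at least $(1-\sqrt{2\alpha})n$, and has minimum degree $\delta(G_0)>(1-1/r-2\sqrt{2\alpha})n$.
   Context: For integers $s_1\geq 2,s_2,\ldots,s_r\geq 1$, $K_r^+(s_1,\ldots,s_r)$ denotes the complete $r$-partite graph with parts of sizes $s_1,\ldots,s_r$ together with one additional edge joining two vertices of the first part (the part of size $s_1$). $\delta(H)$ denotes the minimum degree of a graph $H$.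
   Formalization: The parameter α is taken to be rational instead of real; the real case follows since the edge condition holds on an interval of α with rational left endpoint and conclusion (ii) only weakens as α grows. -}

module Defs where

open import Data.Bool using (Bool; true; false; if_then_else_)
open import Data.Nat as ℕ using (ℕ; zero; suc; _^_; _!)
open import Data.Nat.Properties using (_!≢0)
open import Data.Fin using (Fin; toℕ)
open import Data.List using (List; map; allFin)
open import Data.Nat.ListAction using (sum)
open import Data.Product using (Σ; _×_; _,_; ∃; ∃-syntax)
open import Data.Sum using (_⊎_)
open import Data.Integer using (ℤ; +_)
open import Data.Rational using (ℚ; _/_; _+_; _*_; _-_; _≤_; _<_; 0ℚ; 1ℚ)
open import Relation.Binary.PropositionalEquality using (_≡_; _≢_)
open import Relation.Nullary using (¬_)

ℕtoℚ : ℕ → ℚ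
ℕtoℚ m = (+ m) / 1

-- 1/r for natural r (with 1/0 := 0; only used for r ≥ 2)
inv : ℕ → ℚ
inv zero    = 0ℚ
inv (suc k) = (+ 1) / suc k

-- x ≤ √y   (for y ≥ 0)
LeSqrt : ℚ → ℚ → Set
LeSqrt x y = x ≤ 0ℚ ⊎ x * x ≤ y

-- x < √y   (for y ≥ 0)
LtSqrt : ℚ → ℚ → Set
LtSqrt x y = x < 0ℚ ⊎ x * x < y

record Graph (n : ℕ) : Set where
  field
    adj    : Fin n → Fin n → Bool
    sym    : ∀ i j → adj i j ≡ adj j i
    irrefl : ∀ i → adj i i ≡ false
open Graph public

𝟙 : Bool → ℕ
𝟙 true  = 1
𝟙 false = 0

edgeCount : ∀ {n} → Graph n → ℕ
edgeCount {n} G =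
  sum (map (λ i → sum (map (λ j → if toℕ i ℕ.<ᵇ toℕ j then 𝟙 (adj G i j) else 0) (allFin n))) (allFin n))

VSet : ℕ → Set
VSet n = Fin n → Bool

card : ∀ {n} → VSet n → ℕ
card {n} S = sum (map (λ i → 𝟙 (S i)) (allFin n))

degIn : ∀ {n} → Graph n → VSet n → Fin n → ℕ
degIn {n} G S v = sum (map (λ u → if S u then 𝟙 (adj G v u) else 0) (allFin n))

InducedRPartite : ∀ {n} → Graph n → VSet n → ℕ → Set
InducedRPartite {n} G S r =
  Σ (Fin n → Fin r) λ χ →
    ∀ u v → S u ≡ true → S v ≡ true → adj G u v ≡ true → χ u ≢ χ v

MinDegGtMinusSqrt : ∀ {n} → Graph n → VSet n → ℚ → ℚ → Set
MinDegGtMinusSqrt {n} G S a y =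
  ∀ v → S v ≡ true → LtSqrt (a - (+ degIn G S v) / 1) y

-- G contains (as a not necessarily induced subgraph) K_r^+(t,…,t):
-- an injective map from the vertex set Fin r × Fin t of K_r^+(t,…,t)
-- into V(G) sending edges to edges.  The vertex part₀ = the first part
-- is given as an explicit index p (all parts have equal size t, so
-- which part carries the extra edge is irrelevant up to isomorphism).
ContainsKrPlus : ∀ {n} → Graph n → (r t : ℕ) → Set
ContainsKrPlus {n} G r t =
  Σ (Fin r → Fin t → Fin n) λ f →
    (∀ p a q b → f p a ≡ f q b → (p ≡ q × a ≡ b)) ×
    (∀ p a q b → p ≢ q → adj G (f p a) (f q b) ≡ true) ×
    (∃[ p ] ∃[ a ] ∃[ b ] (a ≢ b × adj G (f p a) (f p b) ≡ true))

-- The exponential:  e^m ≤ x  iff every partial sum Σ_{j<k} m^j / j!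
-- of the exponential series is ≤ x  (the series has positive terms
-- and converges to e^m).

expPartial : ℕ → ℕ → ℚ
expPartial m zero    = 0ℚ
expPartial m (suc k) = expPartial m k + ((+ (m ^ k)) / (k !)) {{k !≢0}}

ExpLe : ℕ → ℕ → Set
ExpLe m x = ∀ k → expPartial m k ≤ ℕtoℚ x

-- With c = r^{-(r+7)(r+1)}/2 we have 1/c = 2·r^{(r+7)(r+1)}.
invC : ℕ → ℕ
invC r = 2 ℕ.* (r ^ ((r ℕ.+ 7) ℕ.* (r ℕ.+ 1)))

-- t = ⌊c ln n⌋  iff  t ≤ c ln n < t+1  iff  e^{t/c} ≤ n < e^{(t+1)/c}
IsFloorCLn : (r n t : ℕ) → Set
IsFloorCLn r n t = ExpLe (t ℕ.* invC r) n × ¬ ExpLe (suc t ℕ.* invC r) n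

{-# OPTIONS --safe #-}
-- Call a vertex set S of size N robust if every vertex of S misses at most
-- (1/r + 1/r⁴)N vertices of S.
--
-- If S is robust and contains a K_{r+1}, then comparing degrees and codegrees of
-- that clique gives an edge uv of it with more than (r−2)(1/r + 1/r⁴)N common
-- neighbours in S.  Cliques with fewer than r vertices then extend in N/r⁴ ways,
-- inside the common neighbourhood of u and v up to r − 1 vertices, and a
-- pigeonhole argument over 2^s subsets blows them up to r − 1 parts of size t
-- adjacent to u and v, plus one more part, to which u and v are added.
--
-- If S is robust without K_{r+1}, fix an r-clique Q, and let V_i be the common
-- neighbourhood of Q without its i-th vertex.  Every vertex has no neighbour in
-- some V_i, and choosing such an i properly colours S.
--
-- If S has more than (1 − 1/r)N²/2 edges, deleting vertices that violate
-- robustness ends at a robust set of size at least N/(2r²) with the same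
-- property; it is not r-partite, so K_r⁺(t, …, t) appears.
--
-- For the theorem put x = √(2α) n.  If x ≥ 1, delete vertices of degree at most
-- (1 − 1/r)n − 2J, where J ≤ x < 2J.  After J deletions there would be too many
-- edges, and if the process stops earlier the remaining set is robust.  If x < 1,
-- then either one deletion gives too many edges, or G is robust, and then an
-- r-partite G has the required minimum degree by a variance computation.
module Submission where

open import Defs

-- Everything combinatorial is stated over ℕ with denominators cleared: `r = p + 1 = k + 2`,
-- `w = r⁴`, `c = r³ + 1`, `α = a / b`, and `c / w = 1/r + 1/r⁴`. The identity `r * c = w + r` makes
-- `r` sets of non-neighbours overshoot the whole set by only `r / w = 1/r³` of it. The slack 1/r⁴
-- has to serve two sides. It must be small enough for the clique and colouring arguments, and large
-- enough to absorb a degree loss of 2J: this is what α < 1/(8r⁸) provides, since then √(2α) n <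
-- n/(2r⁴). No square root is ever formed. J is only known within a factor 2, so αn² may be almost
-- 2J²; the threshold with 2J instead of J makes J deletions gain enough to outweigh this. For x < 1
-- there is no positive J, which is why that case is separate. The exponent of c splits as
-- (r+7)(r+1) = 5r + (r²+3r+7). Each of the r rounds of the blow-up divides the part sizes by
-- `A = r⁵`, which accounts for 5r; the rest pays for the pigeonhole factor 2^M with M = tA^r and
-- for polynomial factors.

module Combinatorics where
  open import Data.Bool using (Bool; true; false; _∧_; not; T; if_then_else_)
  open import Data.Nat
  open import Data.Nat.Properties
  open import Data.Nat.ListAction using (sum)
  open import Data.Nat.Tactic.RingSolver using (solve-∀)
  open import Data.List using (map; tabulate; allFin)
  open import Data.List.Properties using (map-tabulate)
  open import Data.Fin as Fin using (Fin; zero; suc; toℕ; punchIn; punchOut)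
  import Data.Fin.Properties as Fin
  open import Data.Product using (Σ; _×_; _,_; proj₁; proj₂; ∃-syntax)
  open import Data.Sum using (_⊎_; inj₁; inj₂)
  open import Data.Unit using (⊤; tt)
  open import Data.Empty using (⊥; ⊥-elim)
  open import Function using (_∘_; case_of_; id)
  open import Relation.Binary.PropositionalEquality as ≡ using (_≡_; _≢_; refl; cong; cong₂; subst; trans)
  open import Relation.Nullary using (¬_; Dec; yes; no; does; contradiction)
  open import Relation.Nullary.Decidable using (_×-dec_; ¬?; decidable-stable)
  open import Algebra.Properties.Semiring.Sum +-*-semiring using (sum-cong-≗; ∑-distrib-+; ∑-comm; *-distribˡ-sum; sum-remove) renaming (sum to ∑)

  private variable
    m n k : ℕ

  -- Finite sums, cardinalities of vertex sets, and pigeonhole selection.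

  ∑-mono : {f g : Fin n → ℕ} → (∀ i → f i ≤ g i) → ∑ f ≤ ∑ g
  ∑-mono {zero}  h = z≤n
  ∑-mono {suc n} h = +-mono-≤ (h zero) (∑-mono (h ∘ suc))

  ∑-const : ∀ n c → ∑ {n} (λ _ → c) ≡ n * c
  ∑-const zero    c = refl
  ∑-const (suc n) c = cong (c +_) (∑-const n c)

  term≤∑ : (f : Fin n → ℕ) (i : Fin n) → f i ≤ ∑ f
  term≤∑ f zero    = m≤m+n _ _
  term≤∑ f (suc i) = ≤-trans (term≤∑ (f ∘ suc) i) (m≤n+m _ _)

  ∑-distribʳ : (f : Fin n → ℕ) (c : ℕ) → ∑ f * c ≡ ∑ (λ i → f i * c)
  ∑-distribʳ f c = trans (*-comm (∑ f) c)
    (trans (*-distribˡ-sum c f) (sum-cong-≗ (λ i → *-comm c (f i))))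

  _==_ : Fin n → Fin n → Bool
  u == v = does (u Fin.≟ v)

  ==-refl : (u : Fin n) → (u == u) ≡ true
  ==-refl zero    = refl
  ==-refl (suc u) = ==-refl u

  ==⇒≡ : (u v : Fin n) → (u == v) ≡ true → u ≡ v
  ==⇒≡ u v e with u Fin.≟ v
  ... | yes p = p

  ∑-zero : ∀ n → ∑ {n} (λ _ → 0) ≡ 0
  ∑-zero n = trans (∑-const n 0) (*-zeroʳ n)

  ∑-δ : (v : Fin n) (f : Fin n → ℕ) → ∑ (λ u → 𝟙 (u == v) * f u) ≡ f v
  ∑-δ {suc n} zero    f = trans (cong₂ _+_ (+-identityʳ (f zero)) (∑-zero n)) (+-identityʳ _)
  ∑-δ {suc n} (suc v) f = ∑-δ v (f ∘ suc)

  infix 4 _∈_ _⊆_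
  infixl 7 _∩_ _∖_

  _∈_ : Fin n → VSet n → Set
  v ∈ X = X v ≡ true

  _⊆_ : VSet n → VSet n → Set
  X ⊆ Y = ∀ v → v ∈ X → v ∈ Y

  _∩_ : VSet n → VSet n → VSet n
  (X ∩ Y) v = X v ∧ Y v

  ∁ : VSet n → VSet n
  ∁ X v = not (X v)

  _∖_ : VSet n → Fin n → VSet n
  (X ∖ v) u = X u ∧ not (u == v)

  full : VSet n
  full _ = true

  # : VSet n → ℕ
  # X = ∑ (𝟙 ∘ X)

  ∧-true : ∀ {a b} → a ≡ true → b ≡ true → a ∧ b ≡ true
  ∧-true refl refl = refl

  ∧-trueˡ : ∀ {a b} → a ∧ b ≡ true → a ≡ true
  ∧-trueˡ {true} e = refl

  ∧-trueʳ : ∀ {a b} → a ∧ b ≡ true → b ≡ true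
  ∧-trueʳ {true} e = e

  not-true : ∀ {a} → not a ≡ true → a ≡ false
  not-true {false} e = refl

  not-false : ∀ {a} → a ≡ false → not a ≡ true
  not-false refl = refl

  true≢false : ∀ {a} → a ≡ true → a ≡ false → ⊥
  true≢false refl ()

  true? : (b : Bool) → Dec (b ≡ true)
  true? true  = yes refl
  true? false = no λ ()

  𝟙-mono : ∀ {a b} → (a ≡ true → b ≡ true) → 𝟙 a ≤ 𝟙 b
  𝟙-mono {false} h = z≤n
  𝟙-mono {true}  h rewrite h refl = ≤-refl

  𝟙-∧ : ∀ a b → 𝟙 (a ∧ b) ≡ 𝟙 a * 𝟙 b
  𝟙-∧ true  b = ≡.sym (+-identityʳ _)
  𝟙-∧ false b = refl

  𝟙≤1 : ∀ a → 𝟙 a ≤ 1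
  𝟙≤1 true  = ≤-refl
  𝟙≤1 false = z≤n

  #-mono : {X Y : VSet n} → X ⊆ Y → # X ≤ # Y
  #-mono h = ∑-mono (λ i → 𝟙-mono (h i))

  #-split : (X Y : VSet n) → # X ≡ # (X ∩ Y) + # (X ∩ ∁ Y)
  #-split X Y = trans (sum-cong-≗ (λ i → lem (X i) (Y i))) (∑-distrib-+ (𝟙 ∘ (X ∩ Y)) (𝟙 ∘ (X ∩ ∁ Y)))
    where
    lem : ∀ a b → 𝟙 a ≡ 𝟙 (a ∧ b) + 𝟙 (a ∧ not b)
    lem true  true  = refl
    lem true  false = refl
    lem false b     = refl

  #-disjoint : {X Y Z : VSet n} → X ⊆ Z → Y ⊆ Z → (∀ v → v ∈ X → v ∈ Y → ⊥) → # X + # Y ≤ # Z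
  #-disjoint {X = X} {Y} {Z} XZ YZ dis =
    ≤-trans (≤-reflexive (≡.sym (∑-distrib-+ (𝟙 ∘ X) (𝟙 ∘ Y)))) (∑-mono (λ i → lem (XZ i) (YZ i) (dis i)))
    where
    lem : ∀ {a b c} → (a ≡ true → c ≡ true) → (b ≡ true → c ≡ true) →
          (a ≡ true → b ≡ true → ⊥) → 𝟙 a + 𝟙 b ≤ 𝟙 c
    lem {true}  {true}  h k d = ⊥-elim (d refl refl)
    lem {true}  {false} h k d rewrite h refl = ≤-refl
    lem {false} {b}     h k d = 𝟙-mono k

  #-full : ∀ n → # (full {n}) ≡ n
  #-full n = trans (∑-const n 1) (*-identityʳ n)

  #-nonempty : (X : VSet n) → 0 < # X → ∃[ v ] v ∈ X
  #-nonempty {suc n} X h with X zero in eq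
  ... | true  = zero , eq
  ... | false = let (v , v∈) = #-nonempty (X ∘ suc) h in suc v , v∈

  𝟙-∖ : (X : VSet n) (v : Fin n) → v ∈ X → ∀ u → 𝟙 (X u) ≡ 𝟙 (u == v) + 𝟙 ((X ∖ v) u)
  𝟙-∖ X v v∈ u with u Fin.≟ v
  ... | yes refl rewrite v∈ = refl
  ... | no _ with X u
  ...   | true  = refl
  ...   | false = refl

  -- The extra `d` on both sides fits the invariant of the greedy arguments below, where sizes are
  -- compared with multiples of a cost `d` and subtraction is avoided.
  #-nonempty-scaled : ∀ w d (X : VSet n) → d < w * # X + d → ∃[ v ] v ∈ X
  #-nonempty-scaled w d X lt = #-nonempty X (nonzero (# X) lt)
    where
    nonzero : ∀ x → d < w * x + d → 0 < x
    nonzero zero    lt = contradiction (subst (λ y → d < y + d) (*-zeroʳ w) lt) (<-irrefl refl)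
    nonzero (suc x) lt = z<s

  #-∖ : (X : VSet n) (v : Fin n) → v ∈ X → # X ≡ suc (# (X ∖ v))
  #-∖ X v v∈ = trans (sum-cong-≗ (𝟙-∖ X v v∈))
    (trans (∑-distrib-+ (λ u → 𝟙 (u == v)) (𝟙 ∘ (X ∖ v)))
           (cong (_+ # (X ∖ v)) (trans (sum-cong-≗ (λ u → ≡.sym (*-identityʳ (𝟙 (u == v))))) (∑-δ v (λ _ → 1)))))

  #-∖-≤ : (X : VSet n) (v : Fin n) → # X ≤ suc (# (X ∖ v))
  #-∖-≤ X v with X v in eq
  ... | true  = ≤-reflexive (#-∖ X v eq)
  ... | false = m≤n⇒m≤1+n (#-mono {X = X} {X ∖ v} sub)
    where
    sub : X ⊆ X ∖ v
    sub u u∈ with u Fin.≟ v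
    ... | yes refl = ⊥-elim (true≢false u∈ eq)
    ... | no _     = ∧-true u∈ refl

  ∖-⊆ : (X : VSet n) (v : Fin n) → X ∖ v ⊆ X
  ∖-⊆ X v u u∈ = ∧-trueˡ u∈

  ∖-≢ : (X : VSet n) (v : Fin n) → ∀ u → u ∈ X ∖ v → u ≢ v
  ∖-≢ X v u u∈ refl = true≢false (==-refl u) (not-true (∧-trueʳ {X u} u∈))

  Injective : {A B : Set} → (A → B) → Set
  Injective f = ∀ a b → f a ≡ f b → a ≡ b

  enumerate : (X : VSet n) → m ≤ # X → Σ (Fin m → Fin n) λ h → Injective h × (∀ a → h a ∈ X)
  enumerate {m = zero} X le = (λ ()) , (λ ()) , (λ ())
  enumerate {suc n} {suc m} X le with X zero in eq
  ... | true = h′ , inj′ , in′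
    where
    rec = enumerate (X ∘ suc) (s≤s⁻¹ le)
    h′ : Fin (suc m) → Fin (suc n)
    h′ zero    = zero
    h′ (suc a) = suc (proj₁ rec a)
    inj′ : Injective h′
    inj′ zero    zero    e = refl
    inj′ (suc a) (suc b) e = cong suc (proj₁ (proj₂ rec) a b (Fin.suc-injective e))
    in′ : ∀ a → h′ a ∈ X
    in′ zero    = eq
    in′ (suc a) = proj₂ (proj₂ rec) a
  ... | false =
    let (h , inj , h∈) = enumerate (X ∘ suc) le
    in suc ∘ h , (λ a b e → inj a b (Fin.suc-injective e)) , h∈

  -- Halve W along the membership in P 0, keep the larger half, and recurse.
  popular-indices : (s s′ m : ℕ) (P : Fin s → VSet n) (W : VSet n) → 0 < m → 2 ^ s * m ≤ # W →
    (∀ z → z ∈ W → s′ ≤ ∑ (λ a → 𝟙 (P a z))) →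
    Σ (Fin s′ → Fin s) λ g → Injective g ×
    Σ (VSet n) λ W′ → W′ ⊆ W × m ≤ # W′ × (∀ a z → z ∈ W′ → z ∈ P (g a))
  popular-indices s zero m P W m>0 big often =
    (λ ()) , (λ ()) , W , (λ _ z∈ → z∈) , ≤-trans (m≤n*m m (2 ^ s) {{m^n≢0 2 s}}) big , (λ ())
  popular-indices zero (suc s′) m P W m>0 big often
    with (z , z∈) ← #-nonempty W (≤-trans m>0 (≤-trans (m≤m+n m 0) big))
    with () ← often z z∈
  popular-indices (suc s) (suc s′) m P W m>0 big often
    with ≤-total (# (W ∩ P zero)) (# (W ∩ ∁ (P zero)))
  ... | inj₁ le =
    let (g , inj , W′ , sub , sz , all) = popular-indices s (suc s′) m (P ∘ suc) (W ∩ ∁ (P zero)) m>0 half often′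
    in suc ∘ g , (λ a b e → inj a b (Fin.suc-injective e)) , W′ , (λ z z∈ → ∧-trueˡ (sub z z∈)) , sz , all
    where
    half : 2 ^ s * m ≤ # (W ∩ ∁ (P zero))
    half = *-cancelˡ-≤ 2 (begin
      2 * (2 ^ s * m)                       ≡⟨ *-assoc 2 (2 ^ s) m ⟨
      2 ^ suc s * m                         ≤⟨ big ⟩
      # W                                   ≡⟨ #-split W (P zero) ⟩
      # (W ∩ P zero) + # (W ∩ ∁ (P zero))   ≤⟨ +-monoˡ-≤ _ le ⟩
      c + c                                 ≡⟨ cong (c +_) (+-identityʳ c) ⟨
      2 * c                                 ∎)
      where open ≤-Reasoning
            c = # (W ∩ ∁ (P zero))
    often′ : ∀ z → z ∈ W ∩ ∁ (P zero) → suc s′ ≤ ∑ (λ a → 𝟙 (P (suc a) z))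
    often′ z z∈ with q ← often z (∧-trueˡ z∈) rewrite not-true {P zero z} (∧-trueʳ {W z} z∈) = q
  ... | inj₂ le = g′ , inj′ , W′ , (λ z z∈ → ∧-trueˡ (sub z z∈)) , sz , all′
    where
    half : 2 ^ s * m ≤ # (W ∩ P zero)
    half = *-cancelˡ-≤ 2 (begin
      2 * (2 ^ s * m)                       ≡⟨ *-assoc 2 (2 ^ s) m ⟨
      2 ^ suc s * m                         ≤⟨ big ⟩
      # W                                   ≡⟨ #-split W (P zero) ⟩
      # (W ∩ P zero) + # (W ∩ ∁ (P zero))   ≤⟨ +-monoʳ-≤ c le ⟩
      c + c                                 ≡⟨ cong (c +_) (+-identityʳ c) ⟨
      2 * c                                 ∎)
      where open ≤-Reasoning
            c = # (W ∩ P zero)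
    often′ : ∀ z → z ∈ W ∩ P zero → s′ ≤ ∑ (λ a → 𝟙 (P (suc a) z))
    often′ z z∈ with q ← often z (∧-trueˡ z∈) rewrite ∧-trueʳ {W z} {P zero z} z∈ = s≤s⁻¹ q
    rec = popular-indices s s′ m (P ∘ suc) (W ∩ P zero) m>0 half often′
    g   = proj₁ rec
    W′  = proj₁ (proj₂ (proj₂ rec))
    sub = proj₁ (proj₂ (proj₂ (proj₂ rec)))
    sz  = proj₁ (proj₂ (proj₂ (proj₂ (proj₂ rec))))
    all = proj₂ (proj₂ (proj₂ (proj₂ (proj₂ rec))))
    g′ : Fin (suc s′) → Fin (suc s)
    g′ zero    = zero
    g′ (suc a) = suc (g a)
    inj′ : Injective g′
    inj′ zero    zero    e = refl
    inj′ (suc a) (suc b) e = cong suc (proj₁ (proj₂ rec) a b (Fin.suc-injective e))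
    all′ : ∀ a z → z ∈ W′ → z ∈ P (g′ a)
    all′ zero    z z∈ = ∧-trueʳ {W z} (sub z z∈)
    all′ (suc a) z z∈ = all a z z∈

  -- Double counting of the pairs of an index and a member of its set: there are at least
  -- `s * # S / w` of them, with `s = A * s′`. The vertices in fewer than `s′` sets account for at
  -- most `s′ * # S`, which is at most half of that because `2 * w ≤ A`. So at least `# S / (2 * w)`
  -- vertices lie in `s′` or more sets, and the halving argument applies to them.
  popular-indices-of-dense : (w A s′ m : ℕ) (S : VSet n) (P : Fin (A * s′) → VSet n) →
    0 < w → 2 * w ≤ A → 0 < s′ → 0 < m → 2 * w * (2 ^ (A * s′) * m) ≤ # S →
    (∀ a → P a ⊆ S) → (∀ a → # S ≤ w * # (P a)) →
    Σ (Fin s′ → Fin (A * s′)) λ g → Injective g ×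
    Σ (VSet n) λ W → m ≤ # W × (∀ a z → z ∈ W → z ∈ P (g a))
  popular-indices-of-dense {n} w A s′ m S P w>0 2w≤A s′>0 m>0 big P⊆S dense =
    let (g , inj , W′ , _ , sz , all) = popular-indices s s′ m P W m>0 bigW often
    in g , inj , W′ , sz , all
    where
    open ≤-Reasoning
    instance
      w≢0 : NonZero w
      w≢0 = >-nonZero w>0
      A≢0 : NonZero A
      A≢0 = >-nonZero (≤-trans (≤-trans w>0 (m≤n*m w 2)) 2w≤A)
      s′≢0 : NonZero s′
      s′≢0 = >-nonZero s′>0
    s = A * s′
    count : Fin n → ℕ
    count z = ∑ (λ a → 𝟙 (P a z))
    W : VSet n
    W z = s′ ≤ᵇ count z
    often : ∀ z → z ∈ W → s′ ≤ count z
    often z e = ≤ᵇ⇒≤ s′ (count z) (subst T (≡.sym e) tt)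
    count≤s : ∀ z → count z ≤ s
    count≤s z = ≤-trans (∑-mono (λ a → 𝟙≤1 (P a z))) (≤-reflexive (trans (∑-const s 1) (*-identityʳ s)))
    count-bound : ∀ z → count z ≤ 𝟙 (W z) * s + 𝟙 (S z) * s′
    count-bound z with s′ ≤ᵇ count z in rare
    ... | true = ≤-trans (count≤s z) (≤-trans (m≤m+n s 0) (m≤m+n (s + 0) _))
    ... | false with S z in eq
    ...   | true  = ≤-trans (<⇒≤ (≰⇒> (λ le → subst T rare (≤⇒≤ᵇ le)))) (m≤m+n s′ 0)
    ...   | false = ≤-reflexive (trans (sum-cong-≗ (λ a → none a)) (∑-zero s))
      where
      none : ∀ a → 𝟙 (P a z) ≡ 0
      none a with P a z in e
      ... | true  = ⊥-elim (true≢false (P⊆S a z e) eq)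
      ... | false = refl
    incidences : s * # S ≤ w * (# W * s + # S * s′)
    incidences = begin
      s * # S                                              ≡⟨ ∑-const s (# S) ⟨
      ∑ {s} (λ _ → # S)                                    ≤⟨ ∑-mono dense ⟩
      ∑ {s} (λ a → w * # (P a))                            ≡⟨ *-distribˡ-sum w (λ a → # (P a)) ⟨
      w * ∑ {s} (λ a → # (P a))                            ≡⟨ cong (w *_) (∑-comm (λ a z → 𝟙 (P a z))) ⟩
      w * ∑ count                                          ≤⟨ *-monoʳ-≤ w (∑-mono count-bound) ⟩
      w * ∑ (λ z → 𝟙 (W z) * s + 𝟙 (S z) * s′)             ≡⟨ cong (w *_) (∑-distrib-+ (λ z → 𝟙 (W z) * s) (λ z → 𝟙 (S z) * s′)) ⟩
      w * (∑ (λ z → 𝟙 (W z) * s) + ∑ (λ z → 𝟙 (S z) * s′)) ≡⟨ cong (w *_) (cong₂ _+_ (∑-distribʳ (𝟙 ∘ W) s) (∑-distribʳ (𝟙 ∘ S) s′)) ⟨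
      w * (# W * s + # S * s′)                             ∎
    halved : ∀ A s′ w W N → 2 * (w * (W * (A * s′) + N * s′)) ≡ s′ * (A * (2 * w * W) + 2 * w * N)
    halved = solve-∀
    largeW : # S ≤ 2 * w * # W
    largeW = *-cancelˡ-≤ A (+-cancelʳ-≤ (A * # S) _ _ (*-cancelˡ-≤ s′ (begin
      s′ * (A * # S + A * # S)                 ≡⟨ rearr A s′ (# S) ⟩
      2 * (s * # S)                            ≤⟨ *-monoʳ-≤ 2 incidences ⟩
      2 * (w * (# W * s + # S * s′))           ≡⟨ halved A s′ w (# W) (# S) ⟩
      s′ * (A * (2 * w * # W) + 2 * w * # S)   ≤⟨ *-monoʳ-≤ s′ (+-monoʳ-≤ (A * (2 * w * # W)) (*-monoˡ-≤ (# S) 2w≤A)) ⟩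
      s′ * (A * (2 * w * # W) + A * # S)       ∎)))
      where
      rearr : ∀ A s′ N → s′ * (A * N + A * N) ≡ 2 * (A * s′ * N)
      rearr = solve-∀
    bigW : 2 ^ s * m ≤ # W
    bigW = *-cancelˡ-≤ (2 * w) {{m*n≢0 2 w}} (≤-trans big largeW)

  -- Cliques and common neighbourhoods.

  module Neighbourhoods {n : ℕ} (G : Graph n) where

    N : Fin n → VSet n
    N = adj G

    N-sym : ∀ {u v} → v ∈ N u → u ∈ N v
    N-sym {u} {v} e = trans (sym G v u) e

    N-irrefl : ∀ {u} → ¬ (u ∈ N u)
    N-irrefl {u} e = true≢false e (irrefl G u)

    deg miss : VSet n → Fin n → ℕ
    deg  S v = # (S ∩ N v)
    miss S v = # (S ∩ ∁ (N v))

    deg+miss : ∀ S v → # S ≡ deg S v + miss S v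
    deg+miss S v = #-split S (N v)

    -- Robustness in terms of non-neighbours, among which the vertex itself is counted. Every vertex
    -- outside the neighbourhood then costs the same `c * # S / w` in each greedy step.
    HighDeg : (w c : ℕ) → VSet n → Set
    HighDeg w c S = ∀ v → v ∈ S → w * miss S v ≤ c * # S

    -- Existence of a clique as a nested choice, each vertex being taken in the neighbourhood of the
    -- earlier ones; in this form it is decidable by search.
    K : VSet n → ℕ → Set
    K X zero    = ⊤
    K X (suc k) = Σ (Fin n) λ v → v ∈ X × K (X ∩ N v) k

    K? : ∀ X k → Dec (K X k)
    K? X zero    = yes tt
    K? X (suc k) = Fin.any? (λ v → true? (X v) ×-dec K? (X ∩ N v) k)

    IsClique : (Fin k → Fin n) → Set
    IsClique q = ∀ i j → i ≢ j → q j ∈ N (q i)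

    clique : ∀ k X → K X k → Σ (Fin k → Fin n) λ q → (∀ i → q i ∈ X) × IsClique q
    clique zero    X _           = (λ ()) , (λ ()) , (λ ())
    clique (suc k) X (v , v∈ , κ) = q′ , in′ , cl′
      where
      rec = clique k (X ∩ N v) κ
      q′ : Fin (suc k) → Fin n
      q′ zero    = v
      q′ (suc i) = proj₁ rec i
      in′ : ∀ i → q′ i ∈ X
      in′ zero    = v∈
      in′ (suc i) = ∧-trueˡ (proj₁ (proj₂ rec) i)
      cl′ : IsClique q′
      cl′ zero    zero    ne = contradiction refl ne
      cl′ zero    (suc j) ne = ∧-trueʳ {X (q′ (suc j))} (proj₁ (proj₂ rec) j)
      cl′ (suc i) zero    ne = N-sym (∧-trueʳ {X (q′ (suc i))} (proj₁ (proj₂ rec) i))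
      cl′ (suc i) (suc j) ne = proj₂ (proj₂ rec) i j (ne ∘ cong suc)

    K-clique : ∀ k X (q : Fin k → Fin n) → (∀ i → q i ∈ X) → IsClique q → K X k
    K-clique zero    X q q∈ cl = tt
    K-clique (suc k) X q q∈ cl = q zero , q∈ zero ,
      K-clique k (X ∩ N (q zero)) (q ∘ suc)
        (λ i → ∧-true (q∈ (suc i)) (cl zero (suc i) λ ()))
        (λ i j ne → cl (suc i) (suc j) (ne ∘ Fin.suc-injective))

    com : VSet n → (Fin k → Fin n) → VSet n
    com {zero}  X q = X
    com {suc k} X q = com (X ∩ N (q zero)) (q ∘ suc)

    com-⊆ : (X : VSet n) (q : Fin k → Fin n) → com X q ⊆ X
    com-⊆ {zero}  X q u u∈ = u∈
    com-⊆ {suc k} X q u u∈ = ∧-trueˡ (com-⊆ (X ∩ N (q zero)) (q ∘ suc) u u∈)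

    com-adj : (X : VSet n) (q : Fin k → Fin n) → ∀ u → u ∈ com X q → ∀ j → u ∈ N (q j)
    com-adj {suc k} X q u u∈ zero    = ∧-trueʳ {X u} (com-⊆ (X ∩ N (q zero)) (q ∘ suc) u u∈)
    com-adj {suc k} X q u u∈ (suc j) = com-adj (X ∩ N (q zero)) (q ∘ suc) u u∈ j

    ∈-com : (X : VSet n) (q : Fin k → Fin n) → ∀ u → u ∈ X → (∀ j → u ∈ N (q j)) → u ∈ com X q
    ∈-com {zero}  X q u u∈ h = u∈
    ∈-com {suc k} X q u u∈ h = ∈-com (X ∩ N (q zero)) (q ∘ suc) u (∧-true u∈ (h zero)) (h ∘ suc)

    -- Each vertex of `q` removes at most `b / w` vertices from what is left of `X`, all of them
    -- among its non-neighbours in `S`.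
    com-large : (w b : ℕ) {X S : VSet n} (q : Fin k → Fin n) → X ⊆ S → (∀ j → w * miss S (q j) ≤ b) →
      w * # X ≤ w * # (com X q) + k * b
    com-large {zero}  w b q X⊆S h = m≤m+n _ 0
    com-large {suc k} w b {X} {S} q X⊆S h = begin
      w * # X                                  ≡⟨ cong (w *_) (#-split X (N v)) ⟩
      w * (# X′ + # (X ∩ ∁ (N v)))             ≡⟨ *-distribˡ-+ w (# X′) _ ⟩
      w * # X′ + w * # (X ∩ ∁ (N v))           ≤⟨ +-mono-≤ (com-large w b {X′} {S} (q ∘ suc) (λ u u∈ → X⊆S u (∧-trueˡ u∈)) (h ∘ suc)) missed ⟩
      w * # (com X′ (q ∘ suc)) + k * b + b     ≡⟨ +-assoc (w * # (com X q)) (k * b) b ⟩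
      w * # (com X q) + (k * b + b)            ≡⟨ cong (w * # (com X q) +_) (+-comm (k * b) b) ⟩
      w * # (com X q) + suc k * b              ∎
      where
      open ≤-Reasoning
      v = q zero
      X′ = X ∩ N v
      missed : w * # (X ∩ ∁ (N v)) ≤ b
      missed = ≤-trans (*-monoʳ-≤ w (#-mono {X = X ∩ ∁ (N v)} {S ∩ ∁ (N v)}
        (λ u u∈ → ∧-true (X⊆S u (∧-trueˡ u∈)) (∧-trueʳ {X u} u∈)))) (h zero)

    -- Any vertex of `X` may be taken, at a cost of `b / w` vertices. The last one costs nothing, so
    -- `(k - 1) * b < w * # X` is what is needed; the `b` on the right replaces the subtraction.
    K-greedy : (w b : ℕ) {S : VSet n} → (∀ v → v ∈ S → w * miss S v ≤ b) →
      ∀ k X → X ⊆ S → k * b < w * # X + b → K X k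
    K-greedy w b h zero    X X⊆S big = tt
    K-greedy w b {S} h (suc k) X X⊆S big =
      let (v , v∈) = #-nonempty-scaled w b X (≤-<-trans (m≤m+n b (k * b)) big)
          big′ = +-cancelʳ-< b (k * b) (w * # (X ∩ N v) + b) (subst₂< (+-comm b (k * b)) (lower v v∈) big)
      in v , v∈ , K-greedy w b h k (X ∩ N v) (λ u u∈ → X⊆S u (∧-trueˡ u∈)) big′
      where
      lower : ∀ v → v ∈ X → w * # X + b ≤ w * # (X ∩ N v) + b + b
      lower v v∈ = +-monoˡ-≤ b (≤-trans (com-large {1} w b {X} {S} (λ _ → v) X⊆S (λ _ → h v (X⊆S v v∈)))
        (≤-reflexive (cong (w * # (X ∩ N v) +_) (+-identityʳ b))))
      subst₂< : ∀ {a b c d} → a ≡ b → c ≤ d → a < c → b < d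
      subst₂< refl le lt = <-≤-trans lt le

  -- Colouring a robust set that has no clique on r + 1 vertices.

  module Colouring {n : ℕ} (G : Graph n) where
    open Neighbourhoods G

    -- Greedy choice of one vertex in each `U j`. A chosen vertex misses at most `d / w` vertices of
    -- every later set, and `k * d` is used up after all choices but the last.
    K-transversal : (w d : ℕ) → ∀ k (U : Fin k → VSet n) X → (∀ j → U j ⊆ X) →
      (∀ i j → i ≢ j → ∀ z → z ∈ U i → w * # (U j ∩ ∁ (N z)) ≤ d) →
      (∀ j → k * d < w * # (U j) + d) → K X k
    K-transversal w d zero    U X U⊆X few big = tt
    K-transversal w d (suc k) U X U⊆X few big =
      z , U⊆X zero z z∈ , K-transversal w d k U′ (X ∩ N z)
        (λ j u u∈ → ∧-true (U⊆X (suc j) u (∧-trueˡ u∈)) (∧-trueʳ {U (suc j) u} u∈))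
        (λ i j ne y y∈ → ≤-trans
          (*-monoʳ-≤ w (#-mono {X = U′ j ∩ ∁ (N y)} {U (suc j) ∩ ∁ (N y)}
            (λ u u∈ → ∧-true (∧-trueˡ {U (suc j) u} (∧-trueˡ u∈)) (∧-trueʳ {U′ j u} u∈))))
          (few (suc i) (suc j) (ne ∘ Fin.suc-injective) y (∧-trueˡ y∈)))
        big′
      where
      open ≤-Reasoning
      ne = #-nonempty-scaled w d (U zero) (≤-<-trans (m≤m+n d (k * d)) (big zero))
      z  = proj₁ ne
      z∈ = proj₂ ne
      U′ : Fin k → VSet n
      U′ j = U (suc j) ∩ N z
      big′ : ∀ j → k * d < w * # (U′ j) + d
      big′ j = +-cancelˡ-< d _ _ (begin-strict
        d + k * d                                               <⟨ big (suc j) ⟩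
        w * # (U (suc j)) + d                                   ≡⟨ cong (λ x → w * x + d) (#-split (U (suc j)) (N z)) ⟩
        w * (# (U′ j) + # (U (suc j) ∩ ∁ (N z))) + d            ≡⟨ cong (_+ d) (*-distribˡ-+ w (# (U′ j)) _) ⟩
        w * # (U′ j) + w * # (U (suc j) ∩ ∁ (N z)) + d          ≤⟨ +-monoˡ-≤ d (+-monoʳ-≤ (w * # (U′ j)) (few zero (suc j) (λ ()) z z∈)) ⟩
        w * # (U′ j) + d + d                                    ≡⟨ +-comm (w * # (U′ j) + d) d ⟩
        d + (w * # (U′ j) + d)                                  ∎)

    module _ (p w c : ℕ) (rc≡w+r : suc p * c ≡ w + suc p) (2r²<c : 2 * suc p * suc p < c)
             (S : VSet n) (S≢∅ : 0 < # S) (high : HighDeg w c S) (noK : ¬ K S (suc (suc p)))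
             (q : Fin (suc p) → Fin n) (q∈S : ∀ i → q i ∈ S) (q-clique : IsClique q) where

      private
        r : ℕ
        r = suc p

        instance
          S-nonZero : NonZero (# S)
          S-nonZero = >-nonZero S≢∅

      V : Fin r → VSet n
      V i = com S (q ∘ punchIn i)

      V⊆S : ∀ i → V i ⊆ S
      V⊆S i = com-⊆ S (q ∘ punchIn i)

      V-adj : ∀ i l → i ≢ l → ∀ u → u ∈ V i → u ∈ N (q l)
      V-adj i l ne u u∈ = subst (λ l → u ∈ N (q l)) (Fin.punchIn-punchOut ne)
        (com-adj S (q ∘ punchIn i) u u∈ (punchOut ne))

      -- A common vertex is adjacent to all of the clique: only `q i` escapes membership in `V i`,
      -- and it is covered by `V j`.
      V-disjoint : ∀ i j → i ≢ j → ∀ u → u ∈ V i → u ∈ V j → ⊥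
      V-disjoint i j ne u u∈i u∈j = noK (u , V⊆S i u u∈i ,
        K-clique r (S ∩ N u) q (λ l → ∧-true (q∈S l) (N-sym (adjacent l))) q-clique)
        where
        adjacent : ∀ l → u ∈ N (q l)
        adjacent l with i Fin.≟ l
        ... | no  i≢l  = V-adj i l i≢l u u∈i
        ... | yes refl = V-adj j i (ne ∘ ≡.sym) u u∈j

      V-large : ∀ i → w * # S ≤ w * # (V i) + p * (c * # S)
      V-large i = com-large w (c * # S) {S} {S} (q ∘ punchIn i) (λ _ u∈ → u∈) (λ j → high _ (q∈S (punchIn i j)))

      Type : Fin r → Fin n → Set
      Type i z = ∀ u → u ∈ V i → ¬ (u ∈ N z)

      -- Two adjacent vertices of `V i`, with the `p` clique vertices other than `q i`, would form a
      -- clique on `r + 1` vertices.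
      V-type : ∀ i z → z ∈ V i → Type i z
      V-type i z z∈ u u∈ zu = noK (z , V⊆S i z z∈ , u , ∧-true (V⊆S i u u∈) zu ,
        K-clique p (S ∩ N z ∩ N u) (q ∘ punchIn i)
          (λ j → ∧-true (∧-true (q∈S (punchIn i j)) (N-sym (com-adj S (q ∘ punchIn i) z z∈ j)))
                        (N-sym (com-adj S (q ∘ punchIn i) u u∈ j)))
          (λ j l ne → q-clique (punchIn i j) (punchIn i l) (ne ∘ Fin.punchIn-injective i j l)))

      -- A vertex of type `i` already spends almost all its permitted non-neighbours on `V i`, which
      -- has at least `(w - p * c) * # S / w` vertices. As `V j` is disjoint from `V i`, at most
      -- `(r * c - w) * # S / w = r * # S / w` are left for it.
      type-miss : ∀ i j → i ≢ j → ∀ z → z ∈ S → Type i z → w * # (V j ∩ ∁ (N z)) ≤ r * # S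
      type-miss i j ne z z∈ ty = +-cancelʳ-≤ (w * # S) _ _ (begin
        w * a + w * # S                            ≤⟨ +-monoʳ-≤ (w * a) (V-large i) ⟩
        w * a + (w * # (V i) + p * (c * # S))      ≡⟨ +-assoc (w * a) (w * # (V i)) _ ⟨
        w * a + w * # (V i) + p * (c * # S)        ≡⟨ cong (_+ p * (c * # S)) (*-distribˡ-+ w a (# (V i))) ⟨
        w * (a + # (V i)) + p * (c * # S)          ≤⟨ +-monoˡ-≤ (p * (c * # S)) (*-monoʳ-≤ w disj) ⟩
        w * miss S z + p * (c * # S)               ≤⟨ +-monoˡ-≤ (p * (c * # S)) (high z z∈) ⟩
        r * (c * # S)                              ≡⟨ *-assoc r c (# S) ⟨
        r * c * # S                                ≡⟨ cong (_* # S) rc≡w+r ⟩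
        (w + r) * # S                              ≡⟨ *-distribʳ-+ (# S) w r ⟩
        w * # S + r * # S                          ≡⟨ +-comm (w * # S) (r * # S) ⟩
        r * # S + w * # S                          ∎)
        where
        open ≤-Reasoning
        a = # (V j ∩ ∁ (N z))
        disj : a + # (V i) ≤ miss S z
        disj = #-disjoint {X = V j ∩ ∁ (N z)} {V i} {S ∩ ∁ (N z)}
          (λ u u∈ → ∧-true (V⊆S j u (∧-trueˡ u∈)) (∧-trueʳ {V j u} u∈))
          (λ u u∈ → ∧-true (V⊆S i u u∈) (not-false (¬true (ty u u∈))))
          (λ u u∈j u∈i → V-disjoint i j ne u u∈i (∧-trueˡ u∈j))
          where
          ¬true : ∀ {b} → ¬ (b ≡ true) → b ≡ false
          ¬true {true}  h = ⊥-elim (h refl)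
          ¬true {false} h = refl

      -- Otherwise `x`, `y` and one vertex from each `V j` with `j ≢ i` would form a clique on
      -- `r + 1` vertices. By `type-miss`, `y` costs `r * # S / w` in each `V j`, and so does each
      -- vertex of the transversal in the other sets.
      no-extension : ∀ i x y → x ∈ S → y ∈ S → y ∈ N x → Type i y →
        (∀ j → i ≢ j → p * (r * # S) < w * # (V j ∩ N x)) → ⊥
      no-extension i x y x∈ y∈ xy ty big = noK (x , x∈ , y , ∧-true y∈ xy ,
        K-transversal w (r * # S) p U (S ∩ N x ∩ N y)
          (λ j u u∈ → let e = ∧-trueˡ u∈ in
            ∧-true (∧-true (V⊆S (punchIn i j) u (∧-trueˡ e)) (∧-trueʳ {V (punchIn i j) u} e))
                   (∧-trueʳ {(V (punchIn i j) ∩ N x) u} u∈))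
          (λ j l ne z z∈ → ≤-trans
            (*-monoʳ-≤ w (#-mono {X = U l ∩ ∁ (N z)} {V (punchIn i l) ∩ ∁ (N z)}
              (λ u u∈ → ∧-true (∧-trueˡ {V (punchIn i l) u} (∧-trueˡ (∧-trueˡ u∈))) (∧-trueʳ {U l u} u∈))))
            (let z∈V = ∧-trueˡ {V (punchIn i j) z} (∧-trueˡ z∈) in
             type-miss (punchIn i j) (punchIn i l) (ne ∘ Fin.punchIn-injective i j l) z
               (V⊆S (punchIn i j) z z∈V) (V-type (punchIn i j) z z∈V)))
          sizes)
        where
        open ≤-Reasoning
        U : Fin p → VSet n
        U j = V (punchIn i j) ∩ N x ∩ N y
        sizes : ∀ j → p * (r * # S) < w * # (U j) + r * # S
        sizes j = begin-strict
          p * (r * # S)                                      <⟨ big (punchIn i j) (Fin.punchInᵢ≢i i j ∘ ≡.sym) ⟩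
          w * # Vx                                           ≡⟨ cong (w *_) (#-split Vx (N y)) ⟩
          w * (# (U j) + # (Vx ∩ ∁ (N y)))                   ≡⟨ *-distribˡ-+ w (# (U j)) _ ⟩
          w * # (U j) + w * # (Vx ∩ ∁ (N y))                 ≤⟨ +-monoʳ-≤ (w * # (U j)) (≤-trans
            (*-monoʳ-≤ w (#-mono {X = Vx ∩ ∁ (N y)} {V (punchIn i j) ∩ ∁ (N y)}
              (λ u u∈ → ∧-true (∧-trueˡ {V (punchIn i j) u} (∧-trueˡ u∈)) (∧-trueʳ {Vx u} u∈))))
            (type-miss i (punchIn i j) (Fin.punchInᵢ≢i i j ∘ ≡.sym) y y∈ ty)) ⟩
          w * # (U j) + r * # S                              ∎
          where Vx = V (punchIn i j) ∩ N x

      -- Here `x` also misses at most `r * # S / w` of each other `V j`, so `no-extension` applies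
      -- once `p * c + r * r < w`; this follows from `2 * r * r < c`.
      same-type-nonadjacent : ∀ i x y → x ∈ S → y ∈ S → Type i x → Type i y → ¬ (y ∈ N x)
      same-type-nonadjacent i x y x∈ y∈ tx ty xy = no-extension i x y x∈ y∈ xy ty λ j i≢j →
        +-cancelʳ-< (r * # S + p * (c * # S)) _ _ (begin-strict
          p * (r * # S) + (r * # S + p * (c * # S))              ≡⟨ rearr p r c (# S) ⟩
          (p * c + (r * r)) * # S                                <⟨ *-monoˡ-< (# S) numeric ⟩
          w * # S                                                ≤⟨ V-large j ⟩
          w * # (V j) + p * (c * # S)                            ≡⟨ cong (λ z → w * z + p * (c * # S)) (#-split (V j) (N x)) ⟩
          w * (# (V j ∩ N x) + # (V j ∩ ∁ (N x))) + p * (c * # S) ≡⟨ cong (_+ p * (c * # S)) (*-distribˡ-+ w (# (V j ∩ N x)) _) ⟩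
          w * # (V j ∩ N x) + w * # (V j ∩ ∁ (N x)) + p * (c * # S) ≤⟨ +-monoˡ-≤ (p * (c * # S)) (+-monoʳ-≤ (w * # (V j ∩ N x)) (type-miss i j i≢j x x∈ tx)) ⟩
          w * # (V j ∩ N x) + r * # S + p * (c * # S)            ≡⟨ +-assoc (w * # (V j ∩ N x)) _ _ ⟩
          w * # (V j ∩ N x) + (r * # S + p * (c * # S))          ∎)
        where
        open ≤-Reasoning
        rearr : ∀ p r c N → p * (r * N) + (r * N + p * (c * N)) ≡ (p * c + (r + p * r)) * N
        rearr = solve-∀
        numeric : p * c + r * r < w
        numeric = +-cancelʳ-< r _ _ (begin-strict
          p * c + r * r + r      ≤⟨ +-monoʳ-≤ (p * c + r * r) (m≤n*m r r) ⟩
          p * c + r * r + r * r  ≡⟨ double (p * c) r ⟩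
          p * c + 2 * r * r      <⟨ +-monoʳ-< (p * c) 2r²<c ⟩
          p * c + c              ≡⟨ +-comm (p * c) c ⟩
          r * c                  ≡⟨ rc≡w+r ⟩
          w + r                  ∎)
          where
          double : ∀ a r → a + r * r + r * r ≡ a + 2 * r * r
          double = solve-∀

      -- `V i` and `V j` are disjoint and each is nearly a fraction 1/r of `S`, so missing almost
      -- all of both would exceed the fraction of about 1/r that `x` may miss.
      few-neighbours-unique : ∀ x → x ∈ S → ∀ i j → i ≢ j →
        w * # (V i ∩ N x) ≤ p * (r * # S) → p * (r * # S) < w * # (V j ∩ N x)
      few-neighbours-unique x x∈ i j ne few = ≰⇒> λ few′ → <-irrefl refl (begin-strict
        w * # S + w * # S ≤⟨ +-mono-≤ (V-large i) (V-large j) ⟩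
        (w * # (V i) + P) + (w * # (V j) + P) ≡⟨ cong₂ (λ a b → (w * a + P) + (w * b + P)) (#-split (V i) (N x)) (#-split (V j) (N x)) ⟩
        (w * (ai + bi) + P) + (w * (aj + bj) + P) ≡⟨ rearr w ai bi aj bj P ⟩
        w * ai + w * aj + w * (bi + bj) + (P + P) ≤⟨ +-monoˡ-≤ (P + P) (+-mono-≤ (+-mono-≤ few few′) (≤-trans (*-monoʳ-≤ w disj) (high x x∈))) ⟩
        p * (r * # S) + p * (r * # S) + c * # S + (P + P) ≡⟨ rearr₂ p r c (# S) ⟩
        (p * c + p * c + c + 2 * p * r) * # S <⟨ *-monoˡ-< (# S) numeric ⟩
        (w + w) * # S ≡⟨ *-distribʳ-+ (# S) w w ⟩
        w * # S + w * # S ∎)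
        where
        open ≤-Reasoning
        P = p * (c * # S)
        ai = # (V i ∩ N x)
        bi = # (V i ∩ ∁ (N x))
        aj = # (V j ∩ N x)
        bj = # (V j ∩ ∁ (N x))
        disj : bi + bj ≤ miss S x
        disj = #-disjoint {X = V i ∩ ∁ (N x)} {V j ∩ ∁ (N x)} {S ∩ ∁ (N x)}
          (λ u u∈ → ∧-true (V⊆S i u (∧-trueˡ u∈)) (∧-trueʳ {V i u} u∈))
          (λ u u∈ → ∧-true (V⊆S j u (∧-trueˡ u∈)) (∧-trueʳ {V j u} u∈))
          (λ u u∈i u∈j → V-disjoint i j ne u (∧-trueˡ u∈i) (∧-trueˡ u∈j))
        rearr : ∀ w ai bi aj bj P → (w * (ai + bi) + P) + (w * (aj + bj) + P) ≡ w * ai + w * aj + w * (bi + bj) + (P + P)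
        rearr = solve-∀
        rearr₂ : ∀ p r c N → p * (r * N) + p * (r * N) + c * N + (p * (c * N) + p * (c * N)) ≡ (p * c + p * c + c + 2 * p * r) * N
        rearr₂ = solve-∀
        numeric : p * c + p * c + c + 2 * p * r < w + w
        numeric = +-cancelʳ-< (r + r) _ _ (begin-strict
          p * c + p * c + c + 2 * p * r + (r + r)  ≡⟨ e₁ p r c ⟩
          p * c + p * c + c + 2 * (suc p) * r      <⟨ +-monoʳ-< (p * c + p * c + c) 2r²<c ⟩
          p * c + p * c + c + c                    ≡⟨ e₂ p c ⟩
          r * c + r * c                            ≡⟨ cong₂ _+_ rc≡w+r rc≡w+r ⟩
          w + r + (w + r)                          ≡⟨ e₃ w r ⟩
          w + w + (r + r)                          ∎)
          where
          e₁ : ∀ p r c → p * c + p * c + c + 2 * p * r + (r + r) ≡ p * c + p * c + c + 2 * suc p * r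
          e₁ = solve-∀
          e₂ : ∀ p c → p * c + p * c + c + c ≡ suc p * c + suc p * c
          e₂ = solve-∀
          e₃ : ∀ w r → w + r + (w + r) ≡ w + w + (r + r)
          e₃ = solve-∀

      -- Suppose `x` has a neighbour in every `V i`. Take for `i` the only index at which `x` has
      -- few neighbours, or any index if there is none. A neighbour `u` of `x` in `V i` has type
      -- `i`, and `x` has many neighbours in all other sets, so `no-extension` rules out the edge
      -- between `u` and `x`.
      has-type : ∀ x → x ∈ S → ∃[ i ] Type i x
      has-type x x∈ with Fin.any? (λ i → ¬? (Fin.any? (λ u → true? ((V i ∩ N x) u))))
      ... | yes (i , none) = i , λ u u∈ xu → none (u , ∧-true u∈ xu)
      ... | no  all = ⊥-elim contra
        where
        neighbour : ∀ i → ∃[ u ] u ∈ V i ∩ N x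
        neighbour i = decidable-stable (Fin.any? (λ u → true? ((V i ∩ N x) u))) (λ none → all (i , none))
        extend : ∀ i → (∀ j → i ≢ j → p * (r * # S) < w * # (V j ∩ N x)) → ⊥
        extend i = let (u , u∈) = neighbour i ; u∈V = ∧-trueˡ {V i u} u∈ in
          no-extension i x u x∈ (V⊆S i u u∈V) (∧-trueʳ {V i u} u∈) (V-type i u u∈V)
        contra : ⊥
        contra with Fin.any? (λ i → w * # (V i ∩ N x) ≤? p * (r * # S))
        ... | yes (i , few) = extend i (λ j ne → few-neighbours-unique x x∈ i j ne few)
        ... | no  none      = extend zero (λ j _ → ≰⇒> (λ few → none (j , few)))

      types-colour : InducedRPartite G S r
      types-colour = proj₁ ∘ colour , λ u v u∈ v∈ uv same →
        same-type-nonadjacent (proj₁ (colour u)) u v u∈ v∈ (proj₂ (colour u) u∈)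
          (subst (λ i → Type i v) (≡.sym same) (proj₂ (colour v) v∈)) uv
        where
        colour : ∀ v → Σ (Fin r) λ i → v ∈ S → Type i v
        colour v with true? (S v)
        ... | yes v∈ = let (i , ty) = has-type v v∈ in i , λ _ → ty
        ... | no  v∉ = zero , λ v∈ → contradiction v∈ v∉

    module _ (p w c : ℕ) (rc≡w+r : suc p * c ≡ w + suc p) (2r²<c : 2 * suc p * suc p < c) where
      open ≤-Reasoning

      private
        r : ℕ
        r = suc p

      pc<w : p * c < w
      pc<w = +-cancelʳ-< r (p * c) w (begin-strict
        p * c + r    <⟨ +-monoʳ-< (p * c) (≤-<-trans (m≤n*m r (2 * r)) 2r²<c) ⟩
        p * c + c    ≡⟨ +-comm (p * c) c ⟩
        r * c        ≡⟨ rc≡w+r ⟩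
        w + r        ∎)

      r-partite : (S : VSet n) → 0 < # S → HighDeg w c S → ¬ K S (suc r) → InducedRPartite G S r
      r-partite S S≢∅ high noK =
        let (q , q∈S , cl) = clique r S base
        in types-colour p w c rc≡w+r 2r²<c S S≢∅ high noK q q∈S cl
        where
        base : K S r
        base = K-greedy w (c * # S) {S} high r S (λ _ u∈ → u∈) (begin-strict
          c * # S + p * (c * # S)  ≡⟨ +-comm (c * # S) (p * (c * # S)) ⟩
          p * (c * # S) + c * # S  ≡⟨ cong (_+ c * # S) (≡.sym (*-assoc p c (# S))) ⟩
          p * c * # S + c * # S    <⟨ +-monoˡ-< (c * # S) (*-monoˡ-< (# S) {{>-nonZero S≢∅}} pc<w) ⟩
          w * # S + c * # S        ∎)

  -- (a − p)(a − p − 1) ≥ 0 for integers a and p.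
  consecutive-roots : ∀ p a → (suc p + p) * a ≤ a * a + suc p * p
  consecutive-roots p a with ≤-total a p
  ... | inj₁ a≤p with d , refl ← m≤n⇒∃[o]m+o≡n a≤p =
    ≤-trans (m≤m+n _ (d * suc d)) (≤-reflexive (expand a d))
    where
    expand : ∀ a d → (suc (a + d) + (a + d)) * a + d * suc d ≡ a * a + suc (a + d) * (a + d)
    expand = solve-∀
  ... | inj₂ p≤a with m≤n⇒∃[o]m+o≡n p≤a
  ...   | zero , refl = ≤-reflexive (expand p)
    where
    expand : ∀ p → (suc p + p) * (p + 0) ≡ (p + 0) * (p + 0) + suc p * p
    expand = solve-∀
  ...   | suc d , refl = ≤-trans (m≤m+n _ (d * suc d)) (≤-reflexive (expand p d))
    where
    expand : ∀ p d → (suc p + p) * (p + suc d) + d * suc d ≡ (p + suc d) * (p + suc d) + suc p * p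
    expand = solve-∀

  -- From a clique on r + 1 vertices in a robust set to the graph with large parts.

  module Blowup {n : ℕ} (G : Graph n) (k w c : ℕ) where
    open Neighbourhoods G
    open ≤-Reasoning

    private
      p r : ℕ
      p = suc k
      r = suc p

    module _ (S : VSet n) (q : Fin (suc r) → Fin n) (q∈S : ∀ i → q i ∈ S) where

      cod : Fin (suc r) → Fin (suc r) → ℕ
      cod i j = # (S ∩ N (q i) ∩ N (q j))

      private
        -- `α u` is the number of clique vertices adjacent to `u`; it has nothing to do with the
        -- density parameter.
        s α : Fin n → ℕ
        s u = 𝟙 (S u)
        α u = ∑ (λ i → 𝟙 (N (q i) u))
        degs = ∑ (λ i → deg S (q i))

      ∑-deg : ∑ (λ u → s u * α u) ≡ degs
      ∑-deg = begin-equality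
        ∑ (λ u → s u * α u)                       ≡⟨ sum-cong-≗ (λ u → *-distribˡ-sum (s u) (λ i → 𝟙 (N (q i) u))) ⟩
        ∑ (λ u → ∑ (λ i → s u * 𝟙 (N (q i) u)))   ≡⟨ sum-cong-≗ (λ u → sum-cong-≗ (λ i → ≡.sym (𝟙-∧ (S u) (N (q i) u)))) ⟩
        ∑ (λ u → ∑ (λ i → 𝟙 ((S ∩ N (q i)) u)))   ≡⟨ ∑-comm (λ u i → 𝟙 ((S ∩ N (q i)) u)) ⟩
        degs                                      ∎

      ∑-cod : ∑ (λ u → s u * (α u * α u)) ≡ ∑ (λ i → ∑ (cod i))
      ∑-cod = begin-equality
        ∑ (λ u → s u * (α u * α u))
          ≡⟨ sum-cong-≗ (λ u → expand u) ⟩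
        ∑ (λ u → ∑ (λ i → ∑ (λ j → 𝟙 ((S ∩ N (q i) ∩ N (q j)) u))))
          ≡⟨ ∑-comm (λ u i → ∑ (λ j → 𝟙 ((S ∩ N (q i) ∩ N (q j)) u))) ⟩
        ∑ (λ i → ∑ (λ u → ∑ (λ j → 𝟙 ((S ∩ N (q i) ∩ N (q j)) u))))
          ≡⟨ sum-cong-≗ (λ i → ∑-comm (λ u j → 𝟙 ((S ∩ N (q i) ∩ N (q j)) u))) ⟩
        ∑ (λ i → ∑ (cod i)) ∎
        where
        term : ∀ u i j → s u * 𝟙 (N (q i) u) * 𝟙 (N (q j) u) ≡ 𝟙 ((S ∩ N (q i) ∩ N (q j)) u)
        term u i j = trans (cong (_* 𝟙 (N (q j) u)) (≡.sym (𝟙-∧ (S u) (N (q i) u))))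
                           (≡.sym (𝟙-∧ (S u ∧ N (q i) u) (N (q j) u)))
        expand : ∀ u → s u * (α u * α u) ≡ ∑ (λ i → ∑ (λ j → 𝟙 ((S ∩ N (q i) ∩ N (q j)) u)))
        expand u = begin-equality
          s u * (α u * α u)                                          ≡⟨ *-assoc (s u) (α u) (α u) ⟨
          s u * α u * α u                                            ≡⟨ cong (_* α u) (*-distribˡ-sum (s u) (λ i → 𝟙 (N (q i) u))) ⟩
          ∑ (λ i → s u * 𝟙 (N (q i) u)) * α u                        ≡⟨ ∑-distribʳ (λ i → s u * 𝟙 (N (q i) u)) (α u) ⟩
          ∑ (λ i → s u * 𝟙 (N (q i) u) * α u)                        ≡⟨ sum-cong-≗ (λ i → *-distribˡ-sum (s u * 𝟙 (N (q i) u)) (λ j → 𝟙 (N (q j) u))) ⟩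
          ∑ (λ i → ∑ (λ j → s u * 𝟙 (N (q i) u) * 𝟙 (N (q j) u)))    ≡⟨ sum-cong-≗ (λ i → sum-cong-≗ (λ j → term u i j)) ⟩
          ∑ (λ i → ∑ (λ j → 𝟙 ((S ∩ N (q i) ∩ N (q j)) u)))          ∎

      -- The quadratic inequality is applied at `α u` and summed over `S`: first powers add up to
      -- the degrees, squares to the codegrees of all ordered pairs, the diagonal included.
      cod-deg : ∀ x y → (∀ a → x * a ≤ a * a + y) → x * degs ≤ ∑ (λ i → ∑ (cod i)) + y * # S
      cod-deg x y quadratic = begin
        x * degs                                                   ≡⟨ cong (x *_) ∑-deg ⟨
        x * ∑ (λ u → s u * α u)                                    ≡⟨ *-distribˡ-sum x (λ u → s u * α u) ⟩
        ∑ (λ u → x * (s u * α u))                                  ≤⟨ ∑-mono (λ u → pointwise (s u) (α u)) ⟩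
        ∑ (λ u → s u * (α u * α u) + y * s u)                      ≡⟨ ∑-distrib-+ (λ u → s u * (α u * α u)) (λ u → y * s u) ⟩
        ∑ (λ u → s u * (α u * α u)) + ∑ (λ u → y * s u)            ≡⟨ cong₂ _+_ ∑-cod (≡.sym (*-distribˡ-sum y s)) ⟩
        ∑ (λ i → ∑ (cod i)) + y * # S                              ∎
        where
        e₁ : ∀ x s a → x * (s * a) ≡ s * (x * a)
        e₁ = solve-∀
        e₂ : ∀ s a y → s * (a * a + y) ≡ s * (a * a) + y * s
        e₂ = solve-∀
        pointwise : ∀ s a → x * (s * a) ≤ s * (a * a) + y * s
        pointwise s a = begin
          x * (s * a)           ≡⟨ e₁ x s a ⟩
          s * (x * a)           ≤⟨ *-monoʳ-≤ s (quadratic a) ⟩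
          s * (a * a + y)       ≡⟨ e₂ s a y ⟩
          s * (a * a) + y * s   ∎

      -- If all codegrees off the diagonal were small, `cod-deg` would bound the degree sum below
      -- what robustness guarantees. The roots `p` and `r` of the quadratic are chosen because a
      -- vertex has on average about (r+1)(1-1/r) = r - 1/r neighbours in the clique, a value
      -- between them.
      popular-edge : 0 < # S → HighDeg w c S →
        suc r * r * (k * c + 1) + w * (r * p) + 2 * p * suc r * c < 2 * p * suc r * w →
        ∃[ i ] ∃[ j ] (i ≢ j × (k * c + 1) * # S ≤ w * cod i j)
      popular-edge S≢∅ high numeric
        with Fin.any? (λ i → Fin.any? (λ j → ¬? (i Fin.≟ j) ×-dec ((k * c + 1) * # S ≤? w * cod i j)))
      ... | yes found = found
      ... | no  none  = ⊥-elim (<-irrefl refl (begin-strict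
        2 * p * suc r * w * # S
          ≡⟨ e₁ (2 * p) (suc r) w (# S) ⟩
        2 * p * (suc r * (w * # S))
          ≤⟨ *-monoʳ-≤ (2 * p) degs-large ⟩
        2 * p * (w * degs + suc r * (c * # S))
          ≤⟨ ≤-trans (≤-reflexive (*-distribˡ-+ (2 * p) (w * degs) _)) (+-monoˡ-≤ _ degs-small) ⟩
        suc r * (r * B) + w * (r * p * # S) + 2 * p * (suc r * (c * # S))
          ≡⟨ e₂ (suc r) r (k * c + 1) w (r * p) (2 * p) c (# S) ⟩
        (suc r * r * (k * c + 1) + w * (r * p) + 2 * p * suc r * c) * # S
          <⟨ *-monoˡ-< (# S) {{>-nonZero S≢∅}} numeric ⟩
        2 * p * suc r * w * # S ∎))
        where
        B = (k * c + 1) * # S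
        e₁ : ∀ a b w N → a * b * w * N ≡ a * (b * (w * N))
        e₁ = solve-∀
        e₂ : ∀ R r b w y a c N →
          R * (r * (b * N)) + w * (y * N) + a * (R * (c * N)) ≡ (R * r * b + w * y + a * R * c) * N
        e₂ = solve-∀
        row : ∀ i → w * ∑ (cod i) ≤ w * deg S (q i) + r * B
        row i = begin
          w * ∑ (cod i)                                       ≡⟨ cong (w *_) (sum-remove {i = i} (cod i)) ⟩
          w * (cod i i + ∑ (λ j → cod i (punchIn i j)))       ≡⟨ *-distribˡ-+ w (cod i i) _ ⟩
          w * cod i i + w * ∑ (λ j → cod i (punchIn i j))     ≡⟨ cong (w * cod i i +_) (*-distribˡ-sum w (λ j → cod i (punchIn i j))) ⟩
          w * cod i i + ∑ (λ j → w * cod i (punchIn i j))     ≤⟨ +-mono-≤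
            (*-monoʳ-≤ w (#-mono {X = S ∩ N (q i) ∩ N (q i)} {S ∩ N (q i)} (λ u → ∧-trueˡ)))
            (∑-mono (λ j → ≰⇒≥ (λ le → none (i , punchIn i j , Fin.punchInᵢ≢i i j ∘ ≡.sym , le)))) ⟩
          w * deg S (q i) + ∑ {r} (λ _ → B)                   ≡⟨ cong (w * deg S (q i) +_) (∑-const r B) ⟩
          w * deg S (q i) + r * B                             ∎
        -- The diagonal codegrees contribute at most `degs`, which turns the coefficient
        -- `r + p = 2 * p + 1` into `2 * p`.
        degs-small : 2 * p * (w * degs) ≤ suc r * (r * B) + w * (r * p * # S)
        degs-small = +-cancelˡ-≤ (w * degs) _ _ (begin
          w * degs + 2 * p * (w * degs)                        ≡⟨ f₁ p w degs ⟩
          w * ((r + p) * degs)                                 ≤⟨ *-monoʳ-≤ w (cod-deg (r + p) (r * p) (consecutive-roots p)) ⟩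
          w * (∑ (λ i → ∑ (cod i)) + r * p * # S)              ≡⟨ *-distribˡ-+ w (∑ (λ i → ∑ (cod i))) _ ⟩
          w * ∑ (λ i → ∑ (cod i)) + w * (r * p * # S)          ≤⟨ +-monoˡ-≤ (w * (r * p * # S)) (begin
            w * ∑ (λ i → ∑ (cod i))                            ≡⟨ *-distribˡ-sum w (λ i → ∑ (cod i)) ⟩
            ∑ (λ i → w * ∑ (cod i))                            ≤⟨ ∑-mono row ⟩
            ∑ (λ i → w * deg S (q i) + r * B)                  ≡⟨ ∑-distrib-+ (λ i → w * deg S (q i)) (λ _ → r * B) ⟩
            ∑ (λ i → w * deg S (q i)) + ∑ {suc r} (λ _ → r * B) ≡⟨ cong₂ _+_ (≡.sym (*-distribˡ-sum w (λ i → deg S (q i)))) (∑-const (suc r) (r * B)) ⟩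
            w * degs + suc r * (r * B)                         ∎) ⟩
          w * degs + suc r * (r * B) + w * (r * p * # S)       ≡⟨ +-assoc (w * degs) (suc r * (r * B)) _ ⟩
          w * degs + (suc r * (r * B) + w * (r * p * # S))     ∎)
          where
          f₁ : ∀ p w d → w * d + 2 * p * (w * d) ≡ w * ((suc p + p) * d)
          f₁ = solve-∀
        degs-large : suc r * (w * # S) ≤ w * degs + suc r * (c * # S)
        degs-large = begin
          suc r * (w * # S)                                ≡⟨ ∑-const (suc r) (w * # S) ⟨
          ∑ {suc r} (λ _ → w * # S)                        ≤⟨ ∑-mono (λ i → begin
            w * # S                                        ≡⟨ cong (w *_) (deg+miss S (q i)) ⟩
            w * (deg S (q i) + miss S (q i))               ≡⟨ *-distribˡ-+ w (deg S (q i)) _ ⟩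
            w * deg S (q i) + w * miss S (q i)             ≤⟨ +-monoʳ-≤ (w * deg S (q i)) (high (q i) (q∈S i)) ⟩
            w * deg S (q i) + c * # S                      ∎) ⟩
          ∑ (λ i → w * deg S (q i) + c * # S)              ≡⟨ ∑-distrib-+ (λ i → w * deg S (q i)) (λ _ → c * # S) ⟩
          ∑ (λ i → w * deg S (q i)) + ∑ {suc r} (λ _ → c * # S) ≡⟨ cong₂ _+_ (≡.sym (*-distribˡ-sum w (λ i → deg S (q i)))) (∑-const (suc r) (c * # S)) ⟩
          w * degs + suc r * (c * # S)                     ∎

    Multipartite : ∀ {j s} → (Fin j → Fin s → Fin n) → Set
    Multipartite f = (∀ i → Injective (f i)) × (∀ i l → i ≢ l → ∀ a b → f l b ∈ N (f i a))

    multipartite-injective : ∀ {j s} (f : Fin j → Fin s → Fin n) → Multipartite f →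
      ∀ i a l b → f i a ≡ f l b → i ≡ l × a ≡ b
    multipartite-injective f (inj , adjacent) i a l b e with i Fin.≟ l
    ... | yes refl = refl , inj i a b e
    ... | no  ne   = ⊥-elim (N-irrefl (subst (_∈ N (f i a)) (≡.sym e) (adjacent i l ne a b)))

    -- `u` and `v` become the first two vertices of the new part. They may belong to `W`, so both
    -- are removed from it, and `t′` vertices still remain to fill the part.
    attach-edge : ∀ t′ u v → v ∈ N u → (f : Fin p → Fin (suc (suc t′)) → Fin n) (W : VSet n) →
      Multipartite f → suc (suc t′) ≤ # W → (∀ i a → f i a ∈ N u) → (∀ i a → f i a ∈ N v) →
      (∀ i a z → z ∈ W → z ∈ N (f i a)) → ContainsKrPlus G r (suc (suc t′))
    attach-edge t′ u v uv f W mul t≤W f∈Nu f∈Nv W-adj =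
      F , multipartite-injective F (F-inj , λ i l ne a b → F-adj i a l b ne) , F-adj , zero , zero , suc zero , (λ ()) , uv
      where
      t : ℕ
      t = suc (suc t′)
      enum = enumerate {m = t′} (W ∖ u ∖ v) (s≤s⁻¹ (s≤s⁻¹ (begin
        t                         ≤⟨ t≤W ⟩
        # W                       ≤⟨ #-∖-≤ W u ⟩
        suc (# (W ∖ u))           ≤⟨ s≤s (#-∖-≤ (W ∖ u) v) ⟩
        suc (suc (# (W ∖ u ∖ v))) ∎)))
      h : Fin t → Fin n
      h zero          = u
      h (suc zero)    = v
      h (suc (suc a)) = proj₁ enum a
      h∈ : ∀ a → proj₁ enum a ∈ W ∖ u ∖ v
      h∈ = proj₂ (proj₂ enum)
      ≢u : ∀ a → proj₁ enum a ≢ u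
      ≢u a = ∖-≢ W u _ (∖-⊆ (W ∖ u) v _ (h∈ a))
      ≢v : ∀ a → proj₁ enum a ≢ v
      ≢v a = ∖-≢ (W ∖ u) v _ (h∈ a)
      u≢v : u ≢ v
      u≢v u≡v = N-irrefl (subst (_∈ N u) (≡.sym u≡v) uv)
      h-inj : Injective h
      h-inj zero          zero          e = refl
      h-inj zero          (suc zero)    e = contradiction e u≢v
      h-inj zero          (suc (suc b)) e = contradiction (≡.sym e) (≢u b)
      h-inj (suc zero)    zero          e = contradiction (≡.sym e) u≢v
      h-inj (suc zero)    (suc zero)    e = refl
      h-inj (suc zero)    (suc (suc b)) e = contradiction (≡.sym e) (≢v b)
      h-inj (suc (suc a)) zero          e = contradiction e (≢u a)
      h-inj (suc (suc a)) (suc zero)    e = contradiction e (≢v a)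
      h-inj (suc (suc a)) (suc (suc b)) e = cong (λ x → Fin.suc (Fin.suc x)) (proj₁ (proj₂ enum) a b e)
      h-adj : ∀ b i a → h b ∈ N (f i a)
      h-adj zero          i a = N-sym (f∈Nu i a)
      h-adj (suc zero)    i a = N-sym (f∈Nv i a)
      h-adj (suc (suc b)) i a = W-adj i a _ (∖-⊆ W u _ (∖-⊆ (W ∖ u) v _ (h∈ b)))
      F : Fin r → Fin t → Fin n
      F zero    = h
      F (suc i) = f i
      F-inj : ∀ i → Injective (F i)
      F-inj zero    = h-inj
      F-inj (suc i) = proj₁ mul i
      F-adj : ∀ i a l b → i ≢ l → F l b ∈ N (F i a)
      F-adj zero    a zero    b ne = contradiction refl ne
      F-adj zero    a (suc l) b ne = N-sym (h-adj a l b)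
      F-adj (suc i) a zero    b ne = h-adj b i a
      F-adj (suc i) a (suc l) b ne = proj₂ mul i l (ne ∘ cong suc) a b

    module _ (A M : ℕ) (w>0 : 0 < w) (2w≤A : 2 * w ≤ A) (S : VSet n) (high : HighDeg w c S)
             (large : 2 * w * (2 ^ M * M) ≤ # S) where

      private
        instance
          A≢0 : NonZero A
          A≢0 = >-nonZero (≤-trans (≤-trans w>0 (m≤n*m w 2)) 2w≤A)

      -- f is read as a list of A·s cliques λ i → f i a on j vertices.
      common-neighbours : ∀ j s X (f : Fin j → Fin (A * s) → Fin n) → 0 < s → A * s ≤ M →
        X ⊆ S → (∀ i a → f i a ∈ S) → (j * c + 1) * # S ≤ w * # X →
        Σ (Fin s → Fin (A * s)) λ g → Injective g ×
        Σ (VSet n) λ W → s ≤ # W × (∀ a z → z ∈ W → z ∈ com X (λ i → f i (g a)))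
      common-neighbours j s X f s>0 As≤M X⊆S f∈S dense =
        popular-indices-of-dense w A s s S (λ a → com X (λ i → f i a)) w>0 2w≤A s>0 s>0
          (≤-trans (*-monoʳ-≤ (2 * w) (*-mono-≤ (^-monoʳ-≤ 2 As≤M) (≤-trans (m≤n*m s A) As≤M))) large)
          (λ a u u∈ → X⊆S u (com-⊆ X (λ i → f i a) u u∈))
          (λ a → +-cancelʳ-≤ (j * (c * # S)) _ _ (begin
            # S + j * (c * # S)                           ≡⟨ e₁ (# S) j c ⟩
            (j * c + 1) * # S                             ≤⟨ dense ⟩
            w * # X                                       ≤⟨ com-large w (c * # S) {X} {S} (λ i → f i a) X⊆S (λ i → high _ (f∈S i a)) ⟩
            w * # (com X (λ i → f i a)) + j * (c * # S)   ∎))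
        where
        e₁ : ∀ N j c → N + j * (c * N) ≡ (j * c + 1) * N
        e₁ = solve-∀

      -- Adding a part keeps only one in `A` of the indices of the earlier parts, so `j` parts of
      -- size `s` start from size `s * A ^ j`. The density of `X` is exactly what lets cliques on up
      -- to `k` vertices keep `# S / w` common neighbours in `X`, hence up to `p = k + 1` parts.
      grow : ∀ X → X ⊆ S → (k * c + 1) * # S ≤ w * # X → ∀ j s → j ≤ p → 0 < s → s * A ^ j ≤ M →
        Σ (Fin j → Fin s → Fin n) λ f → (∀ i a → f i a ∈ X) × Multipartite f
      grow X X⊆S dense zero    s j≤p s>0 le = (λ ()) , (λ ()) , (λ ()) , (λ ())
      grow X X⊆S dense (suc j) s j<p s>0 le = f′ , f′∈ , inj′ , adj′
        where
        le′ : A * s * A ^ j ≤ M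
        le′ = ≤-trans (≤-reflexive (e A s (A ^ j))) le
          where
          e : ∀ A s x → A * s * x ≡ s * (A * x)
          e = solve-∀
        rec = grow X X⊆S dense j (A * s) (<⇒≤ j<p) (≤-trans s>0 (m≤n*m s A)) le′
        f   = proj₁ rec
        f∈  = proj₁ (proj₂ rec)
        mul = proj₂ (proj₂ rec)
        step = common-neighbours j s X f s>0 (≤-trans (m≤m*n (A * s) (A ^ j) {{m^n≢0 A j}}) le′) X⊆S
          (λ i a → X⊆S _ (f∈ i a))
          (≤-trans (*-monoˡ-≤ (# S) (+-monoˡ-≤ 1 (*-monoˡ-≤ c (s≤s⁻¹ j<p)))) dense)
        g = proj₁ step
        W = proj₁ (proj₂ (proj₂ step))
        W⊆ = proj₂ (proj₂ (proj₂ (proj₂ step)))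
        enum = enumerate W (proj₁ (proj₂ (proj₂ (proj₂ step))))
        h = proj₁ enum
        h∈ : ∀ b a → h b ∈ com X (λ i → f i (g a))
        h∈ b a = W⊆ a (h b) (proj₂ (proj₂ enum) b)
        f′ : Fin (suc j) → Fin s → Fin n
        f′ zero    = h
        f′ (suc i) = f i ∘ g
        f′∈ : ∀ i a → f′ i a ∈ X
        f′∈ zero    a = com-⊆ X (λ i → f i (g a)) (h a) (h∈ a a)
        f′∈ (suc i) a = f∈ i (g a)
        inj′ : ∀ i → Injective (f′ i)
        inj′ zero    = proj₁ (proj₂ enum)
        inj′ (suc i) a b e = proj₁ (proj₂ step) a b (proj₁ mul i (g a) (g b) e)
        adj′ : ∀ i l → i ≢ l → ∀ a b → f′ l b ∈ N (f′ i a)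
        adj′ zero    zero    ne a b = contradiction refl ne
        adj′ zero    (suc l) ne a b = N-sym (com-adj X (λ i → f i (g b)) (h a) (h∈ a b) l)
        adj′ (suc i) zero    ne a b = com-adj X (λ i → f i (g a)) (h b) (h∈ b a) i
        adj′ (suc i) (suc l) ne a b = proj₂ mul i l (ne ∘ cong suc) (g a) (g b)

      -- Inside the common neighbourhood `D` of `u` and `v` only `p` parts can be built. The last
      -- part is sought in all of `S`, where `p * c < w` suffices; it need not be adjacent to `u`
      -- and `v`, because these two join it.
      blow-up-edge : ∀ t′ u v → v ∈ N u → p * c < w →
        (k * c + 1) * # S ≤ w * # (S ∩ N u ∩ N v) → suc (suc t′) * A ^ r ≤ M → ContainsKrPlus G r (suc (suc t′))
      blow-up-edge t′ u v uv pc<w dense le =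
        case grow D D⊆S dense p (A * t) ≤-refl (≤-trans z<s (m≤n*m t A)) le′ of λ (f , f∈ , mul) →
        case common-neighbours p t S f z<s (≤-trans (m≤m*n (A * t) (A ^ p) {{m^n≢0 A p}}) le′)
               (λ _ z∈ → z∈) (λ i a → D⊆S _ (f∈ i a))
               (*-monoˡ-≤ (# S) (≤-trans (≤-reflexive (+-comm (p * c) 1)) pc<w)) of λ (g , g-inj , W , t≤W , W⊆) →
             attach-edge t′ u v uv (λ i → f i ∘ g) W
             ((λ i a b e → g-inj a b (proj₁ mul i (g a) (g b) e)) , λ i l ne a b → proj₂ mul i l ne (g a) (g b)) t≤W
             (λ i a → ∧-trueʳ {S (f i (g a))} (∧-trueˡ {(S ∩ N u) (f i (g a))} (f∈ i (g a))))
             (λ i a → ∧-trueʳ {(S ∩ N u) (f i (g a))} (f∈ i (g a)))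
             (λ i a z z∈ → com-adj S (λ i → f i (g a)) z (W⊆ a z z∈) i)
        where
        t : ℕ
        t = suc (suc t′)
        D = S ∩ N u ∩ N v
        D⊆S : D ⊆ S
        D⊆S z z∈ = ∧-trueˡ {S z} (∧-trueˡ z∈)
        le′ : A * t * A ^ p ≤ M
        le′ = ≤-trans (≤-reflexive (e A t (A ^ p))) le
          where
          e : ∀ A s x → A * s * x ≡ s * (A * x)
          e = solve-∀

  -- Degree sums and the variance of class sizes.

  square-cancel-≤ : ∀ a b → a * a ≤ b * b → a ≤ b
  square-cancel-≤ a b le = ≮⇒≥ λ b<a → <⇒≱ (*-mono-< b<a b<a) le

  distance-square : ∀ a b → ∣ a - b ∣ * ∣ a - b ∣ + 2 * a * b ≡ a * a + b * b
  distance-square a b with ≤-total a b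
  ... | inj₁ a≤b with d , refl ← m≤n⇒∃[o]m+o≡n a≤b rewrite ∣m-m+n∣≡n a d = expand a d
    where
    expand : ∀ a d → d * d + 2 * a * (a + d) ≡ a * a + (a + d) * (a + d)
    expand = solve-∀
  ... | inj₂ b≤a with d , refl ← m≤n⇒∃[o]m+o≡n b≤a rewrite trans (∣-∣-comm (b + d) b) (∣m-m+n∣≡n b d) = expand b d
    where
    expand : ∀ b d → d * d + 2 * (b + d) * b ≡ (b + d) * (b + d) + b * b
    expand = solve-∀

  -- With `N` the total, the sum of `(r * ν j - N)²` over `j` equals `r²` times the sum of squares
  -- minus `r * N²`; of the squared deviations only the `i`-th is kept.
  ∑-variance : ∀ r (ν : Fin r → ℕ) i →
    r * (∑ ν * ∑ ν) + ∣ r * ν i - ∑ ν ∣ * ∣ r * ν i - ∑ ν ∣ ≤ r * r * ∑ (λ j → ν j * ν j)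
  ∑-variance r ν i = +-cancelʳ-≤ (r * (N * N)) _ _ (begin
    r * (N * N) + sq i + r * (N * N)                 ≤⟨ +-monoˡ-≤ (r * (N * N)) (+-monoʳ-≤ (r * (N * N)) (term≤∑ sq i)) ⟩
    r * (N * N) + ∑ sq + r * (N * N)                 ≡⟨ e₁ r N (∑ sq) ⟩
    ∑ sq + 2 * r * N * N                             ≡⟨ cong (∑ sq +_) (*-distribˡ-sum (2 * r * N) ν) ⟩
    ∑ sq + ∑ (λ j → 2 * r * N * ν j)                 ≡⟨ ∑-distrib-+ sq (λ j → 2 * r * N * ν j) ⟨
    ∑ (λ j → sq j + 2 * r * N * ν j)                 ≡⟨ sum-cong-≗ (λ j → trans (cong (sq j +_) (e₂ r N (ν j))) (trans (distance-square (r * ν j) N) (cong (_+ N * N) (e₃ r (ν j))))) ⟩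
    ∑ (λ j → r * r * (ν j * ν j) + N * N)            ≡⟨ ∑-distrib-+ (λ j → r * r * (ν j * ν j)) (λ _ → N * N) ⟩
    ∑ (λ j → r * r * (ν j * ν j)) + ∑ {r} (λ _ → N * N) ≡⟨ cong₂ _+_ (≡.sym (*-distribˡ-sum (r * r) (λ j → ν j * ν j))) (∑-const r (N * N)) ⟩
    r * r * ∑ (λ j → ν j * ν j) + r * (N * N)        ∎)
    where
    open ≤-Reasoning
    N = ∑ ν
    sq : Fin r → ℕ
    sq j = ∣ r * ν j - N ∣ * ∣ r * ν j - N ∣
    e₁ : ∀ r N s → r * (N * N) + s + r * (N * N) ≡ s + 2 * r * N * N
    e₁ = solve-∀
    e₂ : ∀ r N x → 2 * r * N * x ≡ 2 * (r * x) * N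
    e₂ = solve-∀
    e₃ : ∀ r x → r * x * (r * x) ≡ r * r * (x * x)
    e₃ = solve-∀

  module EdgeCounts {n : ℕ} (G : Graph n) where
    open Neighbourhoods G
    open ≤-Reasoning

    -- The degree sum, twice the number of edges inside `S`. The density 1 - 1/r is then the
    -- comparison of `r * E S` with `p * # S²`, without halves.
    E : VSet n → ℕ
    E S = ∑ (λ v → 𝟙 (S v) * deg S v)

    deg≤# : ∀ S v → deg S v ≤ # S
    deg≤# S v = #-mono {X = S ∩ N v} {S} (λ u → ∧-trueˡ)

    E≤#² : ∀ S → E S ≤ # S * # S
    E≤#² S = ≤-trans (∑-mono (λ v → *-monoʳ-≤ (𝟙 (S v)) (deg≤# S v)))
      (≤-reflexive (≡.sym (∑-distribʳ (𝟙 ∘ S) (# S))))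

    E-∖ : ∀ S v → v ∈ S → E S ≤ E (S ∖ v) + 2 * deg S v
    E-∖ S v v∈ = begin
      E S
        ≡⟨ sum-cong-≗ (λ u → trans (cong (_* deg S u) (𝟙-∖ S v v∈ u)) (*-distribʳ-+ (deg S u) (𝟙 (u == v)) _)) ⟩
      ∑ (λ u → 𝟙 (u == v) * deg S u + s′ u * deg S u)
        ≡⟨ ∑-distrib-+ (λ u → 𝟙 (u == v) * deg S u) (λ u → s′ u * deg S u) ⟩
      ∑ (λ u → 𝟙 (u == v) * deg S u) + ∑ (λ u → s′ u * deg S u)
        ≡⟨ cong₂ _+_ (∑-δ v (deg S)) (sum-cong-≗ (λ u → trans (cong (s′ u *_) (deg-∖ u)) (*-distribˡ-+ (s′ u) (𝟙 (N u v)) _))) ⟩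
      deg S v + ∑ (λ u → s′ u * 𝟙 (N u v) + s′ u * deg S′ u)
        ≡⟨ cong (deg S v +_) (∑-distrib-+ (λ u → s′ u * 𝟙 (N u v)) (λ u → s′ u * deg S′ u)) ⟩
      deg S v + (∑ (λ u → s′ u * 𝟙 (N u v)) + E S′)
        ≡⟨ cong (λ x → deg S v + (x + E S′)) (sum-cong-≗ (λ u → trans (cong (λ b → s′ u * 𝟙 b) (sym G u v)) (≡.sym (𝟙-∧ (S′ u) (N v u))))) ⟩
      deg S v + (deg S′ v + E S′)
        ≤⟨ +-monoʳ-≤ (deg S v) (+-monoˡ-≤ (E S′) (#-mono {X = S′ ∩ N v} {S ∩ N v} (λ u u∈ → ∧-true (∖-⊆ S v u (∧-trueˡ u∈)) (∧-trueʳ {S′ u} u∈)))) ⟩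
      deg S v + (deg S v + E S′)
        ≡⟨ e (deg S v) (E S′) ⟩
      E S′ + 2 * deg S v ∎
      where
      S′ = S ∖ v
      s′ : Fin n → ℕ
      s′ u = 𝟙 (S′ u)
      e : ∀ d x → d + (d + x) ≡ x + 2 * d
      e = solve-∀
      deg-∖ : ∀ u → deg S u ≡ 𝟙 (N u v) + deg S′ u
      deg-∖ u = begin-equality
        deg S u                                                              ≡⟨ sum-cong-≗ (λ z → trans (𝟙-∧ (S z) (N u z)) (trans (cong (_* 𝟙 (N u z)) (𝟙-∖ S v v∈ z)) (*-distribʳ-+ (𝟙 (N u z)) (𝟙 (z == v)) (s′ z)))) ⟩
        ∑ (λ z → 𝟙 (z == v) * 𝟙 (N u z) + s′ z * 𝟙 (N u z))                  ≡⟨ ∑-distrib-+ (λ z → 𝟙 (z == v) * 𝟙 (N u z)) (λ z → s′ z * 𝟙 (N u z)) ⟩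
        ∑ (λ z → 𝟙 (z == v) * 𝟙 (N u z)) + ∑ (λ z → s′ z * 𝟙 (N u z))        ≡⟨ cong₂ _+_ (∑-δ v (λ z → 𝟙 (N u z))) (sum-cong-≗ (λ z → ≡.sym (𝟙-∧ (S′ z) (N u z)))) ⟩
        𝟙 (N u v) + deg S′ u                                                 ∎

    module _ (S : VSet n) (r : ℕ) (χ : Fin n → Fin r)
             (proper : ∀ u v → S u ≡ true → S v ≡ true → adj G u v ≡ true → χ u ≢ χ v) where

      private
        class : Fin r → VSet n
        class i u = i == χ u

      ν : Fin r → ℕ
      ν i = # (S ∩ class i)

      class-sum : (f : Fin r → ℕ) → ∑ (λ u → 𝟙 (S u) * f (χ u)) ≡ ∑ (λ i → ν i * f i)
      class-sum f = begin-equality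
        ∑ (λ u → 𝟙 (S u) * f (χ u))                           ≡⟨ sum-cong-≗ (λ u → cong (𝟙 (S u) *_) (≡.sym (∑-δ (χ u) f))) ⟩
        ∑ (λ u → 𝟙 (S u) * ∑ (λ i → 𝟙 (class i u) * f i))     ≡⟨ sum-cong-≗ (λ u → *-distribˡ-sum (𝟙 (S u)) (λ i → 𝟙 (class i u) * f i)) ⟩
        ∑ (λ u → ∑ (λ i → 𝟙 (S u) * (𝟙 (class i u) * f i)))   ≡⟨ sum-cong-≗ (λ u → sum-cong-≗ (λ i → trans (≡.sym (*-assoc (𝟙 (S u)) (𝟙 (class i u)) (f i))) (cong (_* f i) (≡.sym (𝟙-∧ (S u) (class i u)))))) ⟩
        ∑ (λ u → ∑ (λ i → 𝟙 ((S ∩ class i) u) * f i))         ≡⟨ ∑-comm (λ u i → 𝟙 ((S ∩ class i) u) * f i) ⟩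
        ∑ (λ i → ∑ (λ u → 𝟙 ((S ∩ class i) u) * f i))         ≡⟨ sum-cong-≗ (λ i → ≡.sym (∑-distribʳ (𝟙 ∘ (S ∩ class i)) (f i))) ⟩
        ∑ (λ i → ν i * f i)                                   ∎

      ∑-ν : ∑ ν ≡ # S
      ∑-ν = trans (sum-cong-≗ (λ i → ≡.sym (*-identityʳ (ν i))))
        (trans (≡.sym (class-sum (λ _ → 1))) (sum-cong-≗ (λ u → *-identityʳ (𝟙 (S u)))))

      deg+ν≤# : ∀ u → u ∈ S → deg S u + ν (χ u) ≤ # S
      deg+ν≤# u u∈ = #-disjoint {X = S ∩ N u} {S ∩ class (χ u)} {S} (λ _ → ∧-trueˡ) (λ _ → ∧-trueˡ)
        (λ z z∈N z∈C → proper u z u∈ (∧-trueˡ z∈N) (∧-trueʳ {S z} z∈N) (==⇒≡ (χ u) (χ z) (∧-trueʳ {S z} z∈C)))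

      -- `deg+ν≤#` is summed over `S`, where the class sizes `ν (χ u)` add up to the sum of squares.
      -- The slack is kept at `v` alone.
      E+∑ν²-bound : ∀ v m → v ∈ S → deg S v + ν (χ v) + m ≡ # S →
        E S + ∑ (λ i → ν i * ν i) + m ≤ # S * # S
      E+∑ν²-bound v m v∈ eq = begin
        E S + ∑ (λ i → ν i * ν i) + m
          ≡⟨ cong₂ (λ x y → E S + x + y) (≡.sym (class-sum ν)) (≡.sym (∑-δ v (λ _ → m))) ⟩
        E S + ∑ (λ u → 𝟙 (S u) * ν (χ u)) + ∑ (λ u → 𝟙 (u == v) * m)
          ≡⟨ cong (_+ ∑ (λ u → 𝟙 (u == v) * m)) (∑-distrib-+ (λ u → 𝟙 (S u) * deg S u) (λ u → 𝟙 (S u) * ν (χ u))) ⟨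
        ∑ (λ u → 𝟙 (S u) * deg S u + 𝟙 (S u) * ν (χ u)) + ∑ (λ u → 𝟙 (u == v) * m)
          ≡⟨ ∑-distrib-+ (λ u → 𝟙 (S u) * deg S u + 𝟙 (S u) * ν (χ u)) (λ u → 𝟙 (u == v) * m) ⟨
        ∑ (λ u → 𝟙 (S u) * deg S u + 𝟙 (S u) * ν (χ u) + 𝟙 (u == v) * m)
          ≤⟨ ∑-mono pointwise ⟩
        ∑ (λ u → 𝟙 (S u) * # S)
          ≡⟨ ∑-distribʳ (𝟙 ∘ S) (# S) ⟨
        # S * # S ∎
        where
        e₁ : ∀ d x m → 1 * d + 1 * x + 1 * m ≡ d + x + m
        e₁ = solve-∀
        e₂ : ∀ d x m → 1 * d + 1 * x + 0 * m ≡ d + x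
        e₂ = solve-∀
        pointwise : ∀ u → 𝟙 (S u) * deg S u + 𝟙 (S u) * ν (χ u) + 𝟙 (u == v) * m ≤ 𝟙 (S u) * # S
        pointwise u with S u in u∈ | u Fin.≟ v
        ... | true  | yes refl = ≤-trans (≤-reflexive (trans (e₁ (deg S u) (ν (χ u)) m) eq)) (m≤m+n (# S) 0)
        ... | true  | no  _    = ≤-trans (≤-reflexive (e₂ (deg S u) (ν (χ u)) m)) (≤-trans (deg+ν≤# u u∈) (m≤m+n (# S) 0))
        ... | false | yes refl = ⊥-elim (true≢false v∈ u∈)
        ... | false | no  _    = z≤n

      -- Turán's bound with two error terms at `v`: the deviation of its class from the average
      -- size, and the number `m` of its non-neighbours outside its own class.
      partite-bound : ∀ v m → v ∈ S → deg S v + ν (χ v) + m ≡ # S →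
        r * r * E S + r * (# S * # S) + ∣ r * ν (χ v) - # S ∣ * ∣ r * ν (χ v) - # S ∣ + r * r * m ≤ r * r * (# S * # S)
      partite-bound v m v∈ eq = begin
        r * r * E S + r * (# S * # S) + dev (# S) + r * r * m  ≡⟨ cong (_+ r * r * m) (+-assoc (r * r * E S) _ _) ⟩
        r * r * E S + (r * (# S * # S) + dev (# S)) + r * r * m
          ≤⟨ +-monoˡ-≤ (r * r * m) (+-monoʳ-≤ (r * r * E S) (subst (λ x → r * (x * x) + dev x ≤ r * r * ∑ (λ i → ν i * ν i)) ∑-ν (∑-variance r ν (χ v)))) ⟩
        r * r * E S + r * r * ∑ (λ i → ν i * ν i) + r * r * m  ≡⟨ factor (r * r) (E S) (∑ (λ i → ν i * ν i)) m ⟩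
        r * r * (E S + ∑ (λ i → ν i * ν i) + m)                ≤⟨ *-monoʳ-≤ (r * r) (E+∑ν²-bound v m v∈ eq) ⟩
        r * r * (# S * # S) ∎
        where
        dev : ℕ → ℕ
        dev x = ∣ r * ν (χ v) - x ∣ * ∣ r * ν (χ v) - x ∣
        factor : ∀ a x y z → a * x + a * y + a * z ≡ a * (x + y + z)
        factor = solve-∀

    partite-sparse : ∀ p S → 0 < # S → InducedRPartite G S (suc p) → suc p * E S ≤ p * (# S * # S)
    partite-sparse p S S≢∅ (χ , proper) =
      let (v , v∈) = #-nonempty S S≢∅
          (m , eq) = m≤n⇒∃[o]m+o≡n (deg+ν≤# S r χ proper v v∈)
      in +-cancelʳ-≤ (# S * # S) _ _ (*-cancelˡ-≤ r (begin
        r * (r * E S + # S * # S)        ≡⟨ e₁ r (E S) (# S * # S) ⟩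
        r * r * E S + r * (# S * # S)    ≤⟨ m≤m+n _ _ ⟩
        _                                ≤⟨ m≤m+n _ _ ⟩
        _                                ≤⟨ partite-bound S r χ proper v m v∈ eq ⟩
        r * r * (# S * # S)              ≡⟨ e₂ p (# S * # S) ⟩
        r * (p * (# S * # S) + # S * # S) ∎))
      where
      r : ℕ
      r = suc p
      e₁ : ∀ r x y → r * (r * x + y) ≡ r * r * x + r * y
      e₁ = solve-∀
      e₂ : ∀ p y → suc p * suc p * y ≡ suc p * (p * y + y)
      e₂ = solve-∀

  -- Deleting low-degree vertices from a dense set.

  module DeletionArithmetic (p ρ N′ E E′ d : ℕ) where
    open ≤-Reasoning

    private
      r N : ℕ
      r = suc p
      N = suc N′

    module _ (low : r * ρ * d + N < p * ρ * N) (lost : E ≤ E′ + 2 * d) where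

      -- The deficit `σ` is repaid by the deletion: `2 * p * N²` drops by `4 * p * N - 2 * p`, while
      -- `2 * r * E` drops by at most `4 * r * d`, which is less than `4 * p * N - 4 * N / ρ`.
      -- Pruning uses `σ = 0`; with `σ = r` one deletion creates an excess.
      excess-grows : ∀ σ → ρ * σ + 2 * (ρ * p) ≤ 4 * N → 2 * (p * (N * N)) ≤ 2 * (r * E) + σ → p * (N′ * N′) < r * E′
      excess-grows σ large excess = *-cancelˡ-< (2 * ρ) _ _ (+-cancelʳ-< (4 * (r * ρ * d + N)) _ _ (begin-strict
        2 * ρ * (p * (N′ * N′)) + 4 * (r * ρ * d + N)      <⟨ +-monoʳ-< (2 * ρ * (p * (N′ * N′))) (*-monoʳ-< 4 low) ⟩
        2 * ρ * (p * (N′ * N′)) + 4 * (p * ρ * N)          ≡⟨ e₁ ρ p N′ ⟩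
        ρ * (2 * (p * (N * N))) + 2 * (ρ * p)              ≤⟨ +-monoˡ-≤ (2 * (ρ * p)) (*-monoʳ-≤ ρ (≤-trans excess (+-monoˡ-≤ σ (*-monoʳ-≤ 2 (*-monoʳ-≤ r lost))))) ⟩
        ρ * (2 * (r * (E′ + 2 * d)) + σ) + 2 * (ρ * p)     ≡⟨ e₂ ρ r E′ d σ p ⟩
        2 * ρ * (r * (E′ + 2 * d)) + (ρ * σ + 2 * (ρ * p)) ≤⟨ +-monoʳ-≤ (2 * ρ * (r * (E′ + 2 * d))) large ⟩
        2 * ρ * (r * (E′ + 2 * d)) + 4 * N                 ≡⟨ e₃ ρ r E′ d N ⟩
        2 * ρ * (r * E′) + 4 * (r * ρ * d + N)             ∎))
        where
        e₁ : ∀ ρ p n → 2 * ρ * (p * (n * n)) + 4 * (p * ρ * suc n) ≡ ρ * (2 * (p * (suc n * suc n))) + 2 * (ρ * p)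
        e₁ = solve-∀
        e₂ : ∀ ρ r e d σ p → ρ * (2 * (r * (e + 2 * d)) + σ) + 2 * (ρ * p) ≡ 2 * ρ * (r * (e + 2 * d)) + (ρ * σ + 2 * (ρ * p))
        e₂ = solve-∀
        e₃ : ∀ ρ r e d n → 2 * ρ * (r * (e + 2 * d)) + 4 * n ≡ 2 * ρ * (r * e) + 4 * (r * ρ * d + n)
        e₃ = solve-∀

      -- The deletion raises the excess part by more than `4 * N - 2 * ρ * p`, at least `2 * N`, and
      -- this outweighs the loss of `2 * N - 1` in the square.
      potential-grows : ∀ K → ρ * p ≤ N → 2 * (ρ * p * (N * N)) + K ≤ 2 * (r * ρ * E) + N * N →
        2 * (ρ * p * (N′ * N′)) + K ≤ 2 * (r * ρ * E′) + N′ * N′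
      potential-grows K large potential = +-cancelʳ-≤ (4 * (r * ρ * d + N)) _ _ (begin
        2 * (ρ * p * (N′ * N′)) + K + 4 * (r * ρ * d + N)   ≤⟨ +-monoʳ-≤ (2 * (ρ * p * (N′ * N′)) + K) (*-monoʳ-≤ 4 (<⇒≤ low)) ⟩
        2 * (ρ * p * (N′ * N′)) + K + 4 * (p * ρ * N)       ≡⟨ e₁ ρ p N′ K ⟩
        2 * (ρ * p * (N * N)) + K + 2 * (ρ * p)             ≤⟨ +-mono-≤ (≤-trans potential (+-monoˡ-≤ (N * N) (*-monoʳ-≤ 2 (*-monoʳ-≤ (r * ρ) lost)))) (*-monoʳ-≤ 2 large) ⟩
        2 * (r * ρ * (E′ + 2 * d)) + N * N + 2 * N          ≤⟨ m≤m+n _ 1 ⟩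
        2 * (r * ρ * (E′ + 2 * d)) + N * N + 2 * N + 1      ≡⟨ e₂ (r * ρ) E′ d N′ ⟩
        2 * (r * ρ * E′) + N′ * N′ + 4 * (r * ρ * d + N)    ∎)
        where
        e₁ : ∀ ρ p n K → 2 * (ρ * p * (n * n)) + K + 4 * (p * ρ * suc n) ≡ 2 * (ρ * p * (suc n * suc n)) + K + 2 * (ρ * p)
        e₁ = solve-∀
        e₂ : ∀ w e d n → 2 * (w * (e + 2 * d)) + suc n * suc n + 2 * suc n + 1 ≡ 2 * (w * e) + n * n + 4 * (w * d + suc n)
        e₂ = solve-∀

  -- ρ stands for r³; the vertices of a set S that miss at most (1/r + 1/r⁴)|S|
  -- vertices of S are those with  r ρ · miss ≤ (ρ + 1) |S|.
  module Extremal {n : ℕ} (G : Graph n) (k ρ : ℕ)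
                  (ρ≡r³ : ρ ≡ suc (suc k) * suc (suc k) * suc (suc k)) where
    open Neighbourhoods G
    open Colouring G
    open EdgeCounts G
    open ≤-Reasoning

    private
      p r w c A : ℕ
      p = suc k
      r = suc p
      w = r * ρ
      c = suc ρ
      -- This is r⁵: at least `2 * w` since `r ≥ 2`, and a pure power of `r`.
      A = r * (r * ρ)

      rc≡w+r : r * c ≡ w + r
      rc≡w+r = trans (*-suc r ρ) (+-comm r w)

      2≤r : 2 ≤ r
      2≤r = s≤s (s≤s z≤n)

      2r²<c : 2 * r * r < c
      2r²<c = s≤s (≤-trans (*-monoˡ-≤ r (*-monoˡ-≤ r 2≤r)) (≤-reflexive (≡.sym ρ≡r³)))

      instance
        ρ≢0 : NonZero ρ
        ρ≢0 = subst NonZero (≡.sym ρ≡r³) _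

      w>0 : 0 < w
      w>0 = >-nonZero⁻¹ w {{m*n≢0 r ρ}}

      2w≤A : 2 * w ≤ A
      2w≤A = *-monoˡ-≤ w 2≤r

      -- After cancellation only (r-1)(r+1)(r+2) < 2r³ remains, true for every r ≥ 2.
      numeric : suc r * r * (k * c + 1) + w * (r * p) + 2 * p * suc r * c < 2 * p * suc r * w
      numeric = +-cancelʳ-< (2 * ρ) _ _ (begin-strict
        suc r * r * (k * c + 1) + w * (r * p) + 2 * p * suc r * c + 2 * ρ  ≡⟨ e₁ k ρ ⟩
        2 * p * suc r * w + p * suc r * suc (suc r)                        <⟨ +-monoʳ-< (2 * p * suc r * w) small ⟩
        2 * p * suc r * w + 2 * ρ                                          ∎)
        where
        e₁ : ∀ k ρ → (3 + k) * (2 + k) * (k * suc ρ + 1) + (2 + k) * ρ * ((2 + k) * (1 + k)) + 2 * (1 + k) * (3 + k) * suc ρ + 2 * ρ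
          ≡ 2 * (1 + k) * (3 + k) * ((2 + k) * ρ) + (1 + k) * (3 + k) * (4 + k)
        e₁ = solve-∀
        e₂ : ∀ k → 2 * ((2 + k) * (2 + k) * (2 + k)) ≡ suc ((1 + k) * (3 + k) * (4 + k)) + (k * k * k + 4 * k * k + 5 * k + 3)
        e₂ = solve-∀
        small : p * suc r * suc (suc r) < 2 * ρ
        small = ≤-trans (m≤m+n _ (k * k * k + 4 * k * k + 5 * k + 3))
          (≤-reflexive (trans (≡.sym (e₂ k)) (cong (2 *_) (≡.sym ρ≡r³))))

    -- The blow-up needs `2 * w * (2 ^ M * M)` vertices, and a further factor `4 * r²` covers the
    -- sets it is applied to: 2 for the initial deletions and `2 * r²` for pruning.
    Budget : ℕ → Set
    Budget t = 8 * (r * r * w) * (2 ^ (t * A ^ r) * (t * A ^ r)) ≤ n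

    budget>0 : ∀ t → 0 < t → 0 < 2 ^ (t * A ^ r) * (t * A ^ r)
    budget>0 t t>0 = >-nonZero⁻¹ _ {{m*n≢0 (2 ^ (t * A ^ r)) (t * A ^ r) {{m^n≢0 2 (t * A ^ r)}}
      {{m*n≢0 t (A ^ r) {{>-nonZero t>0}} {{m^n≢0 A r {{m*n≢0 r (r * ρ) {{_}} {{m*n≢0 r ρ}}}}}}}}}}

    KrPlus-or-partite : ∀ t′ S → Budget (suc (suc t′)) → n ≤ 4 * (r * r) * # S → HighDeg w c S →
      ContainsKrPlus G r (suc (suc t′)) ⊎ InducedRPartite G S r
    KrPlus-or-partite t′ S budget n≤ high = case K? S (suc r) of λ where
        (no noK) → inj₂ (r-partite p w c rc≡w+r 2r²<c S S≢∅ high noK)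
        (yes κ)  →
          case clique (suc r) S κ of λ (q , q∈S , cl) →
          case Blowup.popular-edge G k w c S q q∈S S≢∅ high numeric of λ (i , j , i≢j , dense) →
          inj₁ (Blowup.blow-up-edge G k w c A M w>0 2w≤A S high large t′ (q i) (q j)
            (cl i j i≢j) (pc<w p w c rc≡w+r 2r²<c) dense ≤-refl)
      where
      M X : ℕ
      M = suc (suc t′) * A ^ r
      X = 2 ^ M * M
      e : ∀ r w X → 4 * (r * r) * (2 * w * X) ≡ 8 * (r * r * w) * X
      e = solve-∀
      large : 2 * w * X ≤ # S
      large = *-cancelˡ-≤ (4 * (r * r)) (≤-trans (≤-reflexive (e r w X)) (≤-trans budget n≤))
      S≢∅ : 0 < # S
      S≢∅ = ≤-trans (*-mono-≤ {1} {2 * w} (≤-trans w>0 (m≤n*m w 2)) (budget>0 (suc (suc t′)) z<s)) large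

    low-degree : ∀ S v → c * # S < w * miss S v → w * deg S v + # S < p * ρ * # S
    low-degree S v low = +-cancelʳ-< (ρ * # S) _ _ (begin-strict
      w * deg S v + # S + ρ * # S          ≡⟨ +-assoc (w * deg S v) (# S) _ ⟩
      w * deg S v + c * # S                <⟨ +-monoʳ-< (w * deg S v) low ⟩
      w * deg S v + w * miss S v           ≡⟨ *-distribˡ-+ w (deg S v) (miss S v) ⟨
      w * (deg S v + miss S v)             ≡⟨ cong (w *_) (deg+miss S v) ⟨
      w * # S                              ≡⟨ e p ρ (# S) ⟩
      p * ρ * # S + ρ * # S                ∎)
      where
      e : ∀ p ρ N → suc p * ρ * N ≡ p * ρ * N + ρ * N
      e = solve-∀

    low? : ∀ S → (∃[ v ] (v ∈ S × c * # S < w * miss S v)) ⊎ HighDeg w c S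
    low? S with Fin.any? (λ v → true? (S v) ×-dec (c * # S <? w * miss S v))
    ... | yes low  = inj₁ low
    ... | no  none = inj₂ λ v v∈ → ≮⇒≥ (λ lt → none (v , v∈ , lt))

    -- 2 (rρ E − ρp N²) + N² does not decrease when a vertex of low degree is
    -- deleted, which bounds the number of deletions.
    prune : ∀ n₀ → 2 * (r * r) * (ρ * p) ≤ n₀ → ∀ fuel S → # S ≤ fuel →
      p * (# S * # S) < r * E S →
      2 * (ρ * p * (# S * # S)) + n₀ * n₀ ≤ 2 * (w * E S) + # S * # S →
      Σ (VSet n) λ S′ → HighDeg w c S′ × p * (# S′ * # S′) < r * E S′ × n₀ ≤ 2 * (r * r) * # S′
    prune n₀ n₀-large fuel S S≤ excess potential = go fuel S≤ (low? S)
      where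
      -- Since `E S ≤ # S²`, the potential is at most `(2 * ρ + 1) * # S²`, which is below
      -- `4 * r⁴ * # S²`, the square of `2 * r² * # S`.
      remains : n₀ ≤ 2 * (r * r) * # S
      remains = square-cancel-≤ n₀ (2 * (r * r) * # S) (+-cancelˡ-≤ (2 * (ρ * p * NN)) _ _ (begin
        2 * (ρ * p * NN) + n₀ * n₀                      ≤⟨ potential ⟩
        2 * (w * E S) + NN                              ≤⟨ +-monoˡ-≤ NN (*-monoʳ-≤ 2 (*-monoʳ-≤ w (E≤#² S))) ⟩
        2 * (w * NN) + NN                               ≡⟨ e₁ p ρ NN ⟩
        2 * (ρ * p * NN) + (2 * ρ + 1) * NN             ≤⟨ +-monoʳ-≤ (2 * (ρ * p * NN)) (*-monoˡ-≤ NN small) ⟩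
        2 * (ρ * p * NN) + (r * (4 * ρ)) * NN           ≡⟨ cong (λ x → 2 * (ρ * p * NN) + (r * (4 * x)) * NN) ρ≡r³ ⟩
        2 * (ρ * p * NN) + (r * (4 * (r * r * r))) * NN ≡⟨ cong (2 * (ρ * p * NN) +_) (e₂ r (# S)) ⟩
        2 * (ρ * p * NN) + 2 * (r * r) * # S * (2 * (r * r) * # S) ∎))
        where
        NN = # S * # S
        e₁ : ∀ p ρ x → 2 * (suc p * ρ * x) + x ≡ 2 * (ρ * p * x) + (2 * ρ + 1) * x
        e₁ = solve-∀
        e₂ : ∀ r y → (r * (4 * (r * r * r))) * (y * y) ≡ 2 * (r * r) * y * (2 * (r * r) * y)
        e₂ = solve-∀
        small : 2 * ρ + 1 ≤ r * (4 * ρ)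
        small = ≤-trans (+-mono-≤ (*-monoˡ-≤ ρ {2} {4} (s≤s (s≤s z≤n))) (≤-trans (>-nonZero⁻¹ ρ) (m≤n*m ρ 4)))
          (≤-trans (≤-reflexive (cong (4 * ρ +_) (≡.sym (+-identityʳ (4 * ρ))))) (*-monoˡ-≤ (4 * ρ) 2≤r))
      go : ∀ fuel → # S ≤ fuel → (∃[ v ] (v ∈ S × c * # S < w * miss S v)) ⊎ HighDeg w c S →
        Σ (VSet n) λ S′ → HighDeg w c S′ × p * (# S′ * # S′) < r * E S′ × n₀ ≤ 2 * (r * r) * # S′
      go fuel S≤ (inj₂ high) = S , high , excess , remains
      go zero S≤ (inj₁ (v , v∈ , low)) = contradiction (≤-trans (≤-reflexive (≡.sym (#-∖ S v v∈))) S≤) (λ ())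
      go (suc fuel) S≤ (inj₁ (v , v∈ , low)) =
        prune n₀ n₀-large fuel (S ∖ v) (s≤s⁻¹ (≤-trans (≤-reflexive (≡.sym N≡)) S≤))
          (excess-grows low′ lost 0 large′ (≤-trans (*-monoʳ-≤ 2 (subst (λ x → p * (x * x) ≤ r * E S) N≡ (<⇒≤ excess))) (m≤m+n _ 0)))
          (potential-grows low′ lost (n₀ * n₀) large
            (subst (λ x → 2 * (ρ * p * (x * x)) + n₀ * n₀ ≤ 2 * (w * E S) + x * x) N≡ potential))
        where
        open DeletionArithmetic p ρ (# (S ∖ v)) (E S) (E (S ∖ v)) (deg S v)
        N≡ : # S ≡ suc (# (S ∖ v))
        N≡ = #-∖ S v v∈
        low′ : r * ρ * deg S v + suc (# (S ∖ v)) < p * ρ * suc (# (S ∖ v))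
        low′ = subst (λ x → r * ρ * deg S v + x < p * ρ * x) N≡ (low-degree S v low)
        lost : E S ≤ E (S ∖ v) + 2 * deg S v
        lost = E-∖ S v v∈
        large : ρ * p ≤ suc (# (S ∖ v))
        large = subst (ρ * p ≤_) N≡ (*-cancelˡ-≤ (2 * (r * r)) (≤-trans n₀-large remains))
        large′ : ρ * 0 + 2 * (ρ * p) ≤ 4 * suc (# (S ∖ v))
        large′ = ≤-trans (≤-reflexive (cong (_+ 2 * (ρ * p)) (*-zeroʳ ρ)))
          (*-mono-≤ {2} {4} (s≤s (s≤s z≤n)) large)

    dense-KrPlus : ∀ t′ S → Budget (suc (suc t′)) → n ≤ 2 * # S → p * (# S * # S) < r * E S →
      ContainsKrPlus G r (suc (suc t′))
    dense-KrPlus t′ S budget n≤ excess =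
      case prune (# S) S-large (# S) S ≤-refl excess potential of λ (S′ , high , excess′ , S≤) →
      case KrPlus-or-partite t′ S′ budget (≤-trans n≤ (≤-trans (*-monoʳ-≤ 2 S≤) (≤-reflexive (e₁ r (# S′))))) high of λ where
        (inj₁ found)   → found
        (inj₂ partite) → contradiction (partite-sparse p S′ (nonempty S′ excess′) partite) (<⇒≱ excess′)
      where
      e₁ : ∀ r x → 2 * (2 * (r * r) * x) ≡ 4 * (r * r) * x
      e₁ = solve-∀
      X : ℕ
      X = 2 ^ (suc (suc t′) * A ^ r) * (suc (suc t′) * A ^ r)
      instance
        X≢0 : NonZero X
        X≢0 = >-nonZero (budget>0 (suc (suc t′)) z<s)
      S-large : 2 * (r * r) * (ρ * p) ≤ # S
      S-large = *-cancelˡ-≤ 2 (begin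
        2 * (2 * (r * r) * (ρ * p))       ≤⟨ *-monoʳ-≤ 2 (*-monoʳ-≤ (2 * (r * r)) (*-monoʳ-≤ ρ (n≤1+n p))) ⟩
        2 * (2 * (r * r) * (ρ * r))       ≤⟨ m≤m+n _ (4 * (r * r * (r * ρ))) ⟩
        2 * (2 * (r * r) * (ρ * r)) + 4 * (r * r * (r * ρ)) ≡⟨ e₂ r ρ ⟩
        8 * (r * r * w)                   ≤⟨ m≤m*n (8 * (r * r * w)) X ⟩
        8 * (r * r * w) * X               ≤⟨ budget ⟩
        n                                 ≤⟨ n≤ ⟩
        2 * # S                           ∎)
        where
        e₂ : ∀ r ρ → 2 * (2 * (r * r) * (ρ * r)) + 4 * (r * r * (r * ρ)) ≡ 8 * (r * r * (r * ρ))
        e₂ = solve-∀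
      potential : 2 * (ρ * p * (# S * # S)) + # S * # S ≤ 2 * (w * E S) + # S * # S
      potential = +-monoˡ-≤ (# S * # S) (*-monoʳ-≤ 2 (begin
        ρ * p * (# S * # S)     ≡⟨ *-assoc ρ p _ ⟩
        ρ * (p * (# S * # S))   ≤⟨ *-monoʳ-≤ ρ (<⇒≤ excess) ⟩
        ρ * (r * E S)           ≡⟨ e₃ ρ r (E S) ⟩
        w * E S                 ∎))
        where
        e₃ : ∀ ρ r x → ρ * (r * x) ≡ r * ρ * x
        e₃ = solve-∀
      nonempty : ∀ S′ → p * (# S′ * # S′) < r * E S′ → 0 < # S′
      nonempty S′ excess′ = n≢0⇒n>0 λ N≡0 → <⇒≱ excess′
        (≤-trans (*-monoʳ-≤ r (E≤#² S′)) (≤-reflexive (trans (cong (λ x → r * (x * x)) N≡0) (trans (*-zeroʳ r) (≡.sym (trans (cong (λ x → p * (x * x)) N≡0) (*-zeroʳ p)))))))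

  -- `J` is the largest integer with `b * J² ≤ M`; it is positive because `b ≤ M`, so
  -- `J + 1 ≤ 2 * J`.
  sqrt-within-factor-2 : ∀ b M m → b ≤ M → M < b * (suc m * suc m) →
    ∃[ J ] (b * (J * J) ≤ M × M < 4 * (b * (J * J)))
  sqrt-within-factor-2 b M zero    b≤M M< = contradiction (≤-trans M< (≤-reflexive (*-identityʳ b))) (≤⇒≯ b≤M)
  sqrt-within-factor-2 b M (suc m) b≤M M< with M <? b * (suc m * suc m)
  ... | yes M<′ = sqrt-within-factor-2 b M m b≤M M<′
  ... | no  M≮  = suc m , ≮⇒≥ M≮ , <-≤-trans M< (≤-trans
    (*-monoʳ-≤ b (*-mono-≤ {suc (suc m)} {2 * suc m} double double)) (≤-reflexive (e b (suc m))))
    where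
    double : suc (suc m) ≤ 2 * suc m
    double = s≤s (≤-trans (s≤s (m≤m+n m 0)) (m≤n+m (suc (m + 0)) m))
    e : ∀ b j → b * (2 * j * (2 * j)) ≡ 4 * (b * (j * j))
    e = solve-∀

  -- The theorem in integer form.

  module Stability {n : ℕ} (G : Graph n) (k ρ t′ : ℕ)
                   (ρ≡r³ : ρ ≡ suc (suc k) * suc (suc k) * suc (suc k))
                   (budget : Extremal.Budget G k ρ ρ≡r³ (suc (suc t′)))
                   (a b : ℕ) (a>0 : 0 < a) where
    open Neighbourhoods G
    open EdgeCounts G
    open Extremal G k ρ ρ≡r³
    open ≤-Reasoning

    private
      p r w c t : ℕ
      p = suc k
      r = suc p
      w = r * ρ
      c = suc ρ
      t = suc (suc t′)

      instance
        ρ≢0 : NonZero ρ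
        ρ≢0 = subst NonZero (≡.sym ρ≡r³) _
        a≢0 : NonZero a
        a≢0 = >-nonZero a>0

    -- Squared forms of the required bounds: `j` is at most √(2a/b) n, and the degree shortfall
    -- `z / r` is less than 2√(2a/b) n.
    record Stable (S : VSet n) : Set where
      field
        partite   : InducedRPartite G S r
        deleted   : ∃[ j ] (n ≤ # S + j × b * (j * j) ≤ 2 * a * (n * n))
        minDegree : ∀ v → v ∈ S → ∃[ z ] (p * n ≤ r * deg S v + z × b * (z * z) < 8 * a * (r * r) * (n * n))

    n-large : 8 * (r * r * w) ≤ n
    n-large = ≤-trans (m≤m*n _ _ {{>-nonZero (budget>0 t z<s)}}) budget

    n>0 : 0 < n
    n>0 = ≤-trans (*-mono-≤ {1} {8} (s≤s z≤n) (>-nonZero⁻¹ (r * r * w) {{m*n≢0 (r * r) w {{_}} {{m*n≢0 r ρ}}}})) n-large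

    private instance
      n≢0 : NonZero n
      n≢0 = >-nonZero n>0

    module _ (α-small : 8 * (w * w) * a < b)
             (edges : b * (p * (n * n)) ≤ b * (r * E full) + a * (r * (n * n))) where

      private instance
        b≢0 : NonZero b
        b≢0 = >-nonZero (≤-<-trans z≤n α-small)

      -- J approximates √(2a/b) n from below.
      module LargeDeviation (J : ℕ) (J≤ : b * (J * J) ≤ 2 * a * (n * n))
                            (J≥ : 2 * a * (n * n) < 4 * (b * (J * J))) where

        -- The upper bound on α enters here: the loss `2 * J` in degree stays within the slack
        -- `n / w` of robustness.
        2wJ≤n : 2 * w * J ≤ n
        2wJ≤n = square-cancel-≤ (2 * w * J) n (*-cancelˡ-≤ b (begin
          b * (2 * w * J * (2 * w * J))   ≡⟨ e₁ b w J ⟩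
          4 * (w * w) * (b * (J * J))     ≤⟨ *-monoʳ-≤ (4 * (w * w)) J≤ ⟩
          4 * (w * w) * (2 * a * (n * n)) ≡⟨ e₂ w a (n * n) ⟩
          8 * (w * w) * a * (n * n)       ≤⟨ *-monoˡ-≤ (n * n) (<⇒≤ α-small) ⟩
          b * (n * n)                     ∎))
          where
          e₁ : ∀ b w j → b * (2 * w * j * (2 * w * j)) ≡ 4 * (w * w) * (b * (j * j))
          e₁ = solve-∀
          e₂ : ∀ w a x → 4 * (w * w) * (2 * a * x) ≡ 8 * (w * w) * a * x
          e₂ = solve-∀

        2J≤n : 2 * J ≤ n
        2J≤n = ≤-trans (*-monoˡ-≤ J {2} {2 * w} (*-monoʳ-≤ 2 (>-nonZero⁻¹ w {{m*n≢0 r ρ}}))) 2wJ≤n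

        edges′ : p * (n * n) < r * E full + 2 * r * (J * J)
        edges′ = *-cancelˡ-< (2 * b) _ _ (begin-strict
          2 * b * (p * (n * n))                                   ≡⟨ *-assoc 2 b _ ⟩
          2 * (b * (p * (n * n)))                                 ≤⟨ *-monoʳ-≤ 2 edges ⟩
          2 * (b * (r * E full) + a * (r * (n * n)))              ≡⟨ e₁ b (r * E full) a r (n * n) ⟩
          2 * b * (r * E full) + r * (2 * a * (n * n))            <⟨ +-monoʳ-< (2 * b * (r * E full)) (*-monoʳ-< r J≥) ⟩
          2 * b * (r * E full) + r * (4 * (b * (J * J)))          ≡⟨ e₂ b (r * E full) r (J * J) ⟩
          2 * b * (r * E full + 2 * r * (J * J))                  ∎)
          where
          e₁ : ∀ b x a r y → 2 * (b * x + a * (r * y)) ≡ 2 * b * x + r * (2 * a * y)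
          e₁ = solve-∀
          e₂ : ∀ b x r y → 2 * b * x + r * (4 * (b * y)) ≡ 2 * b * (x + 2 * r * y)
          e₂ = solve-∀

        -- The degree bound refers to `n`, robustness to `# S`. Writing `n = # S + j` leaves `j` on
        -- the lower side, absorbed by `p * ρ * j` on the other.
        high-degree : ∀ S j → # S + j ≡ n → (∀ v → v ∈ S → p * n < r * deg S v + 2 * r * J) → HighDeg w c S
        high-degree S j size high v v∈ = +-cancelˡ-≤ (w * deg S v) _ _ (begin
          w * deg S v + w * miss S v       ≡⟨ *-distribˡ-+ w (deg S v) (miss S v) ⟨
          w * (deg S v + miss S v)         ≡⟨ cong (w *_) (deg+miss S v) ⟨
          w * # S                          ≡⟨ e₁ p ρ (# S) ⟩
          p * ρ * # S + ρ * # S            ≤⟨ +-monoˡ-≤ (ρ * # S) core ⟩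
          w * deg S v + # S + ρ * # S      ≡⟨ +-assoc (w * deg S v) (# S) _ ⟩
          w * deg S v + c * # S            ∎)
          where
          e₁ : ∀ p ρ N → suc p * ρ * N ≡ p * ρ * N + ρ * N
          e₁ = solve-∀
          e₂ : ∀ p ρ N j → p * ρ * N + p * ρ * j ≡ ρ * (p * (N + j))
          e₂ = solve-∀
          e₃ : ∀ ρ r d J → ρ * (r * d + 2 * r * J) ≡ r * ρ * d + 2 * (r * ρ) * J
          e₃ = solve-∀
          core : p * ρ * # S ≤ w * deg S v + # S
          core = +-cancelʳ-≤ j _ _ (begin
            p * ρ * # S + j                     ≤⟨ +-monoʳ-≤ (p * ρ * # S) (m≤n*m j (p * ρ) {{m*n≢0 p ρ}}) ⟩
            p * ρ * # S + p * ρ * j             ≡⟨ e₂ p ρ (# S) j ⟩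
            ρ * (p * (# S + j))                 ≡⟨ cong (λ x → ρ * (p * x)) size ⟩
            ρ * (p * n)                         ≤⟨ *-monoʳ-≤ ρ (<⇒≤ (high v v∈)) ⟩
            ρ * (r * deg S v + 2 * r * J)       ≡⟨ e₃ ρ r (deg S v) J ⟩
            w * deg S v + 2 * w * J             ≤⟨ +-monoʳ-≤ (w * deg S v) 2wJ≤n ⟩
            w * deg S v + n                     ≡⟨ cong (w * deg S v +_) size ⟨
            w * deg S v + (# S + j)             ≡⟨ +-assoc (w * deg S v) (# S) j ⟨
            w * deg S v + # S + j               ∎)

        finish : ∀ S j → j ≤ J → # S + j ≡ n → (∀ v → v ∈ S → p * n < r * deg S v + 2 * r * J) →
          ContainsKrPlus G r t ⊎ Σ (VSet n) Stable
        finish S j j≤J size high =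
          case KrPlus-or-partite t′ S budget n≤ (high-degree S j size high) of λ where
            (inj₁ found) → inj₁ found
            (inj₂ χ)     → inj₂ (S , record
              { partite   = χ
              ; deleted   = j , ≤-reflexive (≡.sym size) , ≤-trans (*-monoʳ-≤ b (*-mono-≤ j≤J j≤J)) J≤
              ; minDegree = λ v v∈ → shortfall (r * deg S v) (2 * r * J) (high v v∈) ≤-refl
              })
          where
          n≤ : n ≤ 4 * (r * r) * # S
          n≤ = ≤-trans (+-cancelʳ-≤ n _ _ (begin
            n + n                      ≡⟨ e₁ n ⟩
            2 * n                      ≡⟨ cong (2 *_) size ⟨
            2 * (# S + j)              ≡⟨ *-distribˡ-+ 2 (# S) j ⟩
            2 * # S + 2 * j            ≤⟨ +-monoʳ-≤ (2 * # S) (≤-trans (*-monoʳ-≤ 2 j≤J) 2J≤n) ⟩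
            2 * # S + n                ∎)) (*-monoˡ-≤ (# S) {2} {4 * (r * r)} (s≤s (s≤s z≤n)))
            where
            e₁ : ∀ n → n + n ≡ 2 * n
            e₁ = solve-∀
          -- Lowering a positive shortfall by one weakens the strict degree inequality and makes the
          -- inequality between squares strict.
          shortfall : ∀ x y → p * n < x + y → y ≤ 2 * r * J →
            ∃[ z ] (p * n ≤ x + z × b * (z * z) < 8 * a * (r * r) * (n * n))
          shortfall x zero    lt y≤ = 0 , <⇒≤ lt , subst (_< 8 * a * (r * r) * (n * n)) (≡.sym (*-zeroʳ b))
            (>-nonZero⁻¹ _ {{m*n≢0 (8 * a * (r * r)) (n * n) {{m*n≢0 (8 * a) (r * r) {{m*n≢0 8 a}}}} {{m*n≢0 n n}}}})
          shortfall x (suc z) lt y≤ = z , s≤s⁻¹ (≤-trans lt (≤-reflexive (+-suc x z))) , (begin-strict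
            b * (z * z)                            <⟨ *-monoʳ-< b (*-mono-< y≤ y≤) ⟩
            b * (2 * r * J * (2 * r * J))          ≡⟨ e₂ b r J ⟩
            4 * (r * r) * (b * (J * J))            ≤⟨ *-monoʳ-≤ (4 * (r * r)) J≤ ⟩
            4 * (r * r) * (2 * a * (n * n))        ≡⟨ e₃ r a (n * n) ⟩
            8 * a * (r * r) * (n * n)              ∎)
            where
            e₂ : ∀ b r J → b * (2 * r * J * (2 * r * J)) ≡ 4 * (r * r) * (b * (J * J))
            e₂ = solve-∀
            e₃ : ∀ r a x → 4 * (r * r) * (2 * a * x) ≡ 8 * a * (r * r) * x
            e₃ = solve-∀

        -- `i` deletions are still allowed and `j` are done. The last hypothesis adds up what each
        -- deleted vertex of low degree provides: `2 * r` times its degree is at most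
        -- `2 * p * n - 4 * r * J`.
        delete : ∀ i j S → i + j ≡ J → # S + j ≡ n →
          r * E full + j * (4 * r * J) ≤ r * E S + j * (2 * (p * n)) →
          ContainsKrPlus G r t ⊎ Σ (VSet n) Stable
        delete zero j S refl size gained = inj₁ (dense-KrPlus t′ S budget n≤ excess)
          where
          e₁ : ∀ n → n + n ≡ 2 * n
          e₁ = solve-∀
          n≤ : n ≤ 2 * # S
          n≤ = +-cancelʳ-≤ n _ _ (begin
            n + n             ≡⟨ e₁ n ⟩
            2 * n             ≡⟨ cong (2 *_) size ⟨
            2 * (# S + J)     ≡⟨ *-distribˡ-+ 2 (# S) J ⟩
            2 * # S + 2 * J   ≤⟨ +-monoʳ-≤ (2 * # S) 2J≤n ⟩
            2 * # S + n       ∎)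
          e₂ : ∀ p N J → p * (N * N) + (J * (2 * (p * (N + J))) + 2 * suc p * (J * J))
            ≡ p * ((N + J) * (N + J)) + (p * (J * J) + 2 * suc p * (J * J))
          e₂ = solve-∀
          e₃ : ∀ x r J → x + 2 * r * (J * J) + 2 * r * (J * J) ≡ x + J * (4 * r * J)
          e₃ = solve-∀
          e₄ : ∀ a b c → a + b + c ≡ a + (b + c)
          e₄ = solve-∀
          -- After `J` deletions, `r * E S` exceeds `p n² − 2 p n J + 2 r J²`, which is at least
          -- `p (n − J)²` because `p ≤ 2 * r`.
          excess : p * (# S * # S) < r * E S
          excess = +-cancelʳ-< (J * (2 * (p * n)) + 2 * r * (J * J)) _ _ (begin-strict
            p * (# S * # S) + (J * (2 * (p * n)) + 2 * r * (J * J))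
              ≡⟨ cong (λ x → p * (# S * # S) + (J * (2 * (p * x)) + 2 * r * (J * J))) size ⟨
            p * (# S * # S) + (J * (2 * (p * (# S + J))) + 2 * r * (J * J))
              ≡⟨ e₂ p (# S) J ⟩
            p * ((# S + J) * (# S + J)) + (p * (J * J) + 2 * r * (J * J))
              ≡⟨ cong (λ x → p * (x * x) + (p * (J * J) + 2 * r * (J * J))) size ⟩
            p * (n * n) + (p * (J * J) + 2 * r * (J * J))
              <⟨ +-monoˡ-< _ edges′ ⟩
            r * E full + 2 * r * (J * J) + (p * (J * J) + 2 * r * (J * J))
              ≤⟨ +-monoʳ-≤ (r * E full + 2 * r * (J * J)) (+-monoˡ-≤ (2 * r * (J * J)) (*-monoˡ-≤ (J * J) (≤-trans (n≤1+n p) (m≤m+n r (r + 0))))) ⟩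
            r * E full + 2 * r * (J * J) + (2 * r * (J * J) + 2 * r * (J * J))
              ≡⟨ e₄ (r * E full + 2 * r * (J * J)) (2 * r * (J * J)) (2 * r * (J * J)) ⟨
            r * E full + 2 * r * (J * J) + 2 * r * (J * J) + 2 * r * (J * J)
              ≡⟨ cong (_+ 2 * r * (J * J)) (e₃ (r * E full) r J) ⟩
            r * E full + J * (4 * r * J) + 2 * r * (J * J)
              ≤⟨ +-monoˡ-≤ (2 * r * (J * J)) gained ⟩
            r * E S + J * (2 * (p * n)) + 2 * r * (J * J)
              ≡⟨ e₄ (r * E S) (J * (2 * (p * n))) (2 * r * (J * J)) ⟩
            r * E S + (J * (2 * (p * n)) + 2 * r * (J * J)) ∎)
        delete (suc i) j S i+j≡J size gained
          with Fin.any? (λ v → true? (S v) ×-dec (r * deg S v + 2 * r * J ≤? p * n))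
        ... | no none = finish S j (≤-trans (m≤n+m j (suc i)) (≤-reflexive i+j≡J)) size
          (λ v v∈ → ≰⇒> (λ le → none (v , v∈ , le)))
        ... | yes (v , v∈ , low) = delete i (suc j) (S ∖ v) (trans (+-suc i j) i+j≡J)
          (trans (+-suc (# (S ∖ v)) j) (trans (cong (_+ j) (≡.sym (#-∖ S v v∈))) size))
          (begin
            r * E full + (4 * r * J + j * (4 * r * J))                             ≡⟨ e₁ (r * E full) (4 * r * J) (j * (4 * r * J)) ⟩
            r * E full + j * (4 * r * J) + 4 * r * J                               ≤⟨ +-monoˡ-≤ (4 * r * J) gained ⟩
            r * E S + j * (2 * (p * n)) + 4 * r * J                                ≤⟨ +-monoˡ-≤ (4 * r * J) (+-monoˡ-≤ (j * (2 * (p * n))) (*-monoʳ-≤ r (E-∖ S v v∈))) ⟩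
            r * (E (S ∖ v) + 2 * deg S v) + j * (2 * (p * n)) + 4 * r * J          ≡⟨ e₂ r (E (S ∖ v)) (deg S v) (j * (2 * (p * n))) J ⟩
            r * E (S ∖ v) + (2 * (r * deg S v + 2 * r * J) + j * (2 * (p * n)))    ≤⟨ +-monoʳ-≤ (r * E (S ∖ v)) (+-monoˡ-≤ (j * (2 * (p * n))) (*-monoʳ-≤ 2 low)) ⟩
            r * E (S ∖ v) + (2 * (p * n) + j * (2 * (p * n)))                      ∎)
          where
          e₁ : ∀ x y z → x + (y + z) ≡ x + z + y
          e₁ = solve-∀
          e₂ : ∀ r e d y J → r * (e + 2 * d) + y + 4 * r * J ≡ r * e + (2 * (r * d + 2 * r * J) + y)
          e₂ = solve-∀

        conclusion : ContainsKrPlus G r t ⊎ Σ (VSet n) Stable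
        conclusion = delete J 0 full (+-identityʳ J) (trans (+-identityʳ _) (#-full n)) ≤-refl

      module SmallDeviation (small : 2 * a * (n * n) < b) where

        edges′ : 2 * (p * (n * n)) ≤ 2 * (r * E full) + r
        edges′ = *-cancelˡ-≤ b (begin
          b * (2 * (p * (n * n)))                       ≡⟨ e₁ b (p * (n * n)) ⟩
          2 * (b * (p * (n * n)))                       ≤⟨ *-monoʳ-≤ 2 edges ⟩
          2 * (b * (r * E full) + a * (r * (n * n)))    ≡⟨ e₂ b (r * E full) a r (n * n) ⟩
          b * (2 * (r * E full)) + r * (2 * a * (n * n)) ≤⟨ +-monoʳ-≤ (b * (2 * (r * E full))) (*-monoʳ-≤ r (<⇒≤ small)) ⟩
          b * (2 * (r * E full)) + r * b                ≡⟨ e₃ b (2 * (r * E full)) r ⟩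
          b * (2 * (r * E full) + r)                    ∎)
          where
          e₁ : ∀ b x → b * (2 * x) ≡ 2 * (b * x)
          e₁ = solve-∀
          e₂ : ∀ b x a r y → 2 * (b * x + a * (r * y)) ≡ b * (2 * x) + r * (2 * a * y)
          e₂ = solve-∀
          e₃ : ∀ b x r → b * x + r * b ≡ b * (x + r)
          e₃ = solve-∀

        delete-one : ∀ v → c * # (full {n}) < w * miss full v → ContainsKrPlus G r t
        delete-one v low = dense-KrPlus t′ (full ∖ v) budget n≤
          (excess-grows low′ (E-∖ full v refl) r large (subst (λ x → 2 * (p * (x * x)) ≤ 2 * (r * E full) + r) n≡ edges′))
          where
          open DeletionArithmetic p ρ (# (full ∖ v)) (E full) (E (full ∖ v)) (deg full v)
          n≡ : n ≡ suc (# (full ∖ v))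
          n≡ = trans (≡.sym (#-full n)) (#-∖ full v refl)
          low′ : r * ρ * deg full v + suc (# (full ∖ v)) < p * ρ * suc (# (full ∖ v))
          low′ = subst (λ x → r * ρ * deg full v + x < p * ρ * x) (#-∖ full v refl) (low-degree full v low)
          w≤n : w ≤ n
          w≤n = ≤-trans (m≤n*m w (r * r)) (≤-trans (m≤n*m (r * r * w) 8) n-large)
          large : ρ * r + 2 * (ρ * p) ≤ 4 * suc (# (full ∖ v))
          large = begin
            ρ * r + 2 * (ρ * p)   ≤⟨ +-monoʳ-≤ (ρ * r) (*-monoʳ-≤ 2 (*-monoʳ-≤ ρ (n≤1+n p))) ⟩
            ρ * r + 2 * (ρ * r)   ≤⟨ m≤m+n _ (ρ * r) ⟩
            ρ * r + 2 * (ρ * r) + ρ * r ≡⟨ e₁ ρ r ⟩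
            4 * w                 ≤⟨ *-monoʳ-≤ 4 w≤n ⟩
            4 * n                 ≡⟨ cong (4 *_) n≡ ⟩
            4 * suc (# (full ∖ v)) ∎
            where
            e₁ : ∀ ρ r → ρ * r + 2 * (ρ * r) + ρ * r ≡ 4 * (r * ρ)
            e₁ = solve-∀
          n≤ : n ≤ 2 * # (full ∖ v)
          n≤ = double (# (full ∖ v)) n≡ (≤-trans (*-mono-≤ {2} {8} {1} {r * r * w} (s≤s (s≤s z≤n)) (>-nonZero⁻¹ (r * r * w) {{m*n≢0 (r * r) w {{_}} {{m*n≢0 r ρ}}}})) n-large)
            where
            double : ∀ x → n ≡ suc x → 2 ≤ n → n ≤ 2 * x
            double x refl (s≤s 1≤x) = ≤-trans (+-monoˡ-≤ x 1≤x) (≤-reflexive (cong (x +_) (≡.sym (+-identityʳ x))))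

        -- The edge count bounds both error terms of `partite-bound` at `v` together by `α r² n²`.
        -- As `2 α n² < 1`, the integer `m` vanishes, so `v` is adjacent to everything outside its
        -- class, and the deviation of the size of that class bounds the shortfall.
        balanced : InducedRPartite G full r → Stable full
        balanced (χ , proper) = record
          { partite   = χ , proper
          ; deleted   = 0 , ≤-reflexive (trans (≡.sym (#-full n)) (≡.sym (+-identityʳ _))) , ≤-trans (≤-reflexive (*-zeroʳ b)) z≤n
          ; minDegree = λ v _ → let (m , eq) = m≤n⇒∃[o]m+o≡n (deg+ν≤# full r χ proper v refl) in
              degree v m (trans eq (#-full n))
                (subst (λ x → r * r * E full + r * (x * x) + ∣ r * νv v - x ∣ * ∣ r * νv v - x ∣ + r * r * m ≤ r * r * (x * x))
                  (#-full n) (partite-bound full r χ proper v m refl eq))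
          }
          where
          νv : Fin n → ℕ
          νv v = ν full r χ proper (χ v)
          bound : ∀ dev m → r * r * E full + r * (n * n) + dev + r * r * m ≤ r * r * (n * n) →
            b * dev + b * (r * r) * m ≤ a * (r * r) * (n * n)
          bound dev m le = +-cancelˡ-≤ (b * (r * r * E full + r * (n * n))) _ _ (begin
            b * (r * r * E full + r * (n * n)) + (b * dev + b * (r * r) * m) ≡⟨ e₁ b (r * r * E full + r * (n * n)) dev (r * r) m ⟩
            b * (r * r * E full + r * (n * n) + dev + r * r * m)             ≤⟨ *-monoʳ-≤ b le ⟩
            b * (r * r * (n * n))                                            ≡⟨ e₂ b p (n * n) ⟩
            r * (b * (p * (n * n))) + b * (r * (n * n))                      ≤⟨ +-monoˡ-≤ (b * (r * (n * n))) (*-monoʳ-≤ r edges) ⟩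
            r * (b * (r * E full) + a * (r * (n * n))) + b * (r * (n * n))   ≡⟨ e₃ b r (E full) a (n * n) ⟩
            b * (r * r * E full + r * (n * n)) + a * (r * r) * (n * n)       ∎)
            where
            e₁ : ∀ b x d y m → b * x + (b * d + b * y * m) ≡ b * (x + d + y * m)
            e₁ = solve-∀
            e₂ : ∀ b p x → b * (suc p * suc p * x) ≡ suc p * (b * (p * x)) + b * (suc p * x)
            e₂ = solve-∀
            e₃ : ∀ b r e a x → r * (b * (r * e) + a * (r * x)) + b * (r * x) ≡ b * (r * r * e + r * x) + a * (r * r) * x
            e₃ = solve-∀
          degree : ∀ v m → deg full v + νv v + m ≡ n →
            r * r * E full + r * (n * n) + ∣ r * νv v - n ∣ * ∣ r * νv v - n ∣ + r * r * m ≤ r * r * (n * n) →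
            ∃[ z ] (p * n ≤ r * deg full v + z × b * (z * z) < 8 * a * (r * r) * (n * n))
          degree v (suc m) eq le = contradiction small (≤⇒≯ (begin
            b                    ≤⟨ *-cancelʳ-≤ b (a * (n * n)) (r * r) (begin
              b * (r * r)                         ≤⟨ m≤m*n (b * (r * r)) (suc m) ⟩
              b * (r * r) * suc m                 ≤⟨ m≤n+m _ (b * (∣ r * νv v - n ∣ * ∣ r * νv v - n ∣)) ⟩
              _                                   ≤⟨ bound _ (suc m) le ⟩
              a * (r * r) * (n * n)               ≡⟨ e₁ a (r * r) (n * n) ⟩
              a * (n * n) * (r * r)               ∎) ⟩
            a * (n * n)          ≤⟨ m≤n*m (a * (n * n)) 2 ⟩
            2 * (a * (n * n))    ≡⟨ *-assoc 2 a _ ⟨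
            2 * a * (n * n)      ∎))
            where
            e₁ : ∀ a x y → a * x * y ≡ a * y * x
            e₁ = solve-∀
          degree v zero eq le = z , +-cancelʳ-≤ n _ _ (begin
            p * n + n                          ≡⟨ +-comm (p * n) n ⟩
            r * n                              ≡⟨ cong (r *_) (trans (≡.sym eq) (+-identityʳ _)) ⟩
            r * (deg full v + νv v)            ≡⟨ *-distribˡ-+ r (deg full v) (νv v) ⟩
            r * deg full v + r * νv v          ≤⟨ +-monoʳ-≤ (r * deg full v) (≤-trans (m≤n+∣m-n∣ (r * νv v) n) (≤-reflexive (+-comm n z))) ⟩
            r * deg full v + (z + n)           ≡⟨ +-assoc (r * deg full v) z n ⟨
            r * deg full v + z + n             ∎) , (begin-strict
            b * (z * z)                        ≤⟨ ≤-trans (m≤m+n _ (b * (r * r) * 0)) (bound (z * z) 0 le) ⟩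
            a * (r * r) * (n * n)              <⟨ m<m+n _ (>-nonZero⁻¹ (7 * (a * (r * r) * (n * n))) {{m*n≢0 7 (a * (r * r) * (n * n)) {{_}} {{m*n≢0 (a * (r * r)) (n * n) {{m*n≢0 a (r * r)}} {{m*n≢0 n n}}}}}}) ⟩
            a * (r * r) * (n * n) + 7 * (a * (r * r) * (n * n)) ≡⟨ e₁ a (r * r) (n * n) ⟩
            8 * a * (r * r) * (n * n)          ∎)
            where
            z : ℕ
            z = ∣ r * νv v - n ∣
            e₁ : ∀ a x y → a * x * y + 7 * (a * x * y) ≡ 8 * a * x * y
            e₁ = solve-∀

        conclusion : ContainsKrPlus G r t ⊎ Σ (VSet n) Stable
        conclusion = case low? full of λ where
          (inj₁ (v , _ , low)) → inj₁ (delete-one v low)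
          (inj₂ high)          → case KrPlus-or-partite t′ full budget
              (≤-trans (≤-reflexive (≡.sym (#-full n))) (m≤n*m (# (full {n})) (4 * (r * r)))) high of λ where
            (inj₁ found)   → inj₁ found
            (inj₂ partite) → inj₂ (full , balanced partite)

      stability : ContainsKrPlus G r t ⊎ Σ (VSet n) Stable
      stability with 2 * a * (n * n) <? b
      ... | yes small = SmallDeviation.conclusion small
      ... | no  large = case sqrt-within-factor-2 b (2 * a * (n * n)) n (≮⇒≥ large) bounded of λ
          (J , J≤ , J≥) → LargeDeviation.conclusion J J≤ J≥
        where
        bounded : 2 * a * (n * n) < b * (suc n * suc n)
        bounded = ≤-<-trans (*-monoˡ-≤ (n * n) 2a≤b) (*-monoʳ-< b (*-mono-< (n<1+n n) (n<1+n n)))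
          where
          2a≤b : 2 * a ≤ b
          2a≤b = ≤-trans (*-monoˡ-≤ a {2} {8 * (w * w)} (≤-trans (s≤s (s≤s z≤n)) (m≤m*n 8 (w * w) {{m*n≢0 w w {{m*n≢0 r ρ}} {{m*n≢0 r ρ}}}}))) (<⇒≤ α-small)

  -- Agreement with the list sums of the statement.

  sum-allFin : ∀ {n} (f : Fin n → ℕ) → sum (map f (allFin n)) ≡ ∑ f
  sum-allFin {n} f = trans (cong sum (map-tabulate {n = n} id f)) (sum-tabulate f)
    where
    sum-tabulate : ∀ {n} (f : Fin n → ℕ) → sum (tabulate f) ≡ ∑ f
    sum-tabulate {zero}  f = refl
    sum-tabulate {suc n} f = cong (f zero +_) (sum-tabulate (f ∘ suc))

  card≡# : ∀ {n} (S : VSet n) → card S ≡ # S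
  card≡# S = sum-allFin (𝟙 ∘ S)

  module _ {n : ℕ} (G : Graph n) where
    open Neighbourhoods G
    open EdgeCounts G

    degIn≡deg : ∀ S v → degIn G S v ≡ deg S v
    degIn≡deg S v = trans (sum-allFin (λ u → if S u then 𝟙 (adj G v u) else 0)) (sum-cong-≗ λ u → lem (S u))
      where
      lem : ∀ s {b} → (if s then 𝟙 b else 0) ≡ 𝟙 (s ∧ b)
      lem true  = refl
      lem false = refl

    handshake : E full ≡ 2 * edgeCount G
    handshake = begin-equality
      E full                                                 ≡⟨ sum-cong-≗ (λ i → trans (*-identityˡ (deg full i)) (trans (sum-cong-≗ (split i)) (∑-distrib-+ (h i) (λ j → h j i)))) ⟩
      ∑ (λ i → ∑ (h i) + ∑ (λ j → h j i))                    ≡⟨ ∑-distrib-+ (λ i → ∑ (h i)) (λ i → ∑ (λ j → h j i)) ⟩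
      ∑ (λ i → ∑ (h i)) + ∑ (λ i → ∑ (λ j → h j i))          ≡⟨ cong (∑ (λ i → ∑ (h i)) +_) (∑-comm (λ i j → h j i)) ⟩
      ∑ (λ i → ∑ (h i)) + ∑ (λ i → ∑ (h i))                  ≡⟨ cong (∑ (λ i → ∑ (h i)) +_) (+-identityʳ _) ⟨
      2 * ∑ (λ i → ∑ (h i))                                  ≡⟨ cong (2 *_) (trans (sum-allFin (λ i → sum (map (h i) (allFin n)))) (sum-cong-≗ (λ i → sum-allFin (h i)))) ⟨
      2 * edgeCount G                                        ∎
      where
      open ≤-Reasoning
      h : Fin n → Fin n → ℕ
      h i j = if toℕ i <ᵇ toℕ j then 𝟙 (adj G i j) else 0
      split : ∀ i j → 𝟙 (adj G i j) ≡ h i j + h j i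
      split i j with toℕ i <ᵇ toℕ j in i<j | toℕ j <ᵇ toℕ i in j<i
      ... | true  | true  = ⊥-elim (<-asym (<ᵇ⇒< (toℕ i) (toℕ j) (subst T (≡.sym i<j) tt)) (<ᵇ⇒< (toℕ j) (toℕ i) (subst T (≡.sym j<i) tt)))
      ... | true  | false = ≡.sym (+-identityʳ _)
      ... | false | true  = cong 𝟙 (sym G i j)
      ... | false | false = cong 𝟙 (subst (λ j → adj G i j ≡ false) i≡j (irrefl G i))
        where
        i≡j : i ≡ j
        i≡j = Fin.toℕ-injective (≤-antisym (≮⇒≥ (λ lt → subst T j<i (<⇒<ᵇ lt))) (≮⇒≥ (λ lt → subst T i<j (<⇒<ᵇ lt))))

  -- How large n must be: powers, factorials and the exponential.

  ^-distribʳ-* : ∀ q x y → (x * y) ^ q ≡ x ^ q * y ^ q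
  ^-distribʳ-* zero    x y = refl
  ^-distribʳ-* (suc q) x y = trans (cong (x * y *_) (^-distribʳ-* q x y)) (e x y (x ^ q) (y ^ q))
    where
    e : ∀ a b c d → a * b * (c * d) ≡ a * c * (b * d)
    e = solve-∀

  n!≤n^n : ∀ q → q ! ≤ q ^ q
  n!≤n^n zero    = ≤-refl
  n!≤n^n (suc q) = *-monoʳ-≤ (suc q) (≤-trans (n!≤n^n q) (^-monoˡ-≤ q (n≤1+n q)))

  -- The q-th term of the series for e^(2q) is already at least 2^q.
  2^q≤ : ∀ q x → (2 * q) ^ q ≤ x * q ! → 2 ^ q ≤ x
  2^q≤ q x le = *-cancelʳ-≤ (2 ^ q) x (q !) {{q !≢0}} (begin
    2 ^ q * q !    ≤⟨ *-monoʳ-≤ (2 ^ q) (n!≤n^n q) ⟩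
    2 ^ q * q ^ q  ≡⟨ ^-distribʳ-* q 2 q ⟨
    (2 * q) ^ q    ≤⟨ le ⟩
    x * q !        ∎)
    where open ≤-Reasoning

  n≤2^n : ∀ n → n ≤ 2 ^ n
  n≤2^n zero    = z≤n
  n≤2^n (suc n) = +-mono-≤ (m^n>0 2 n) (≤-trans (n≤2^n n) (m≤m+n _ 0))

  -- All factors are turned into powers of 2, using `M ≤ 2 ^ M`, which gives the exponent
  -- `3 + 6 * r + 2 * M`. It is at most `M * (5 + 6 * r)`; here `M = t * r ^ (5 * r)`, and
  -- `5 + 6 * r` is below the remaining power `C` of `r`.
  budget : ∀ k t n → 0 < t → let r = suc (suc k) ; ρ = r * r * r ; M = t * (r * (r * ρ)) ^ r in
    2 ^ (t * r ^ ((r + 7) * (r + 1))) ≤ n → 8 * (r * r * (r * ρ)) * (2 ^ M * M) ≤ n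
  budget k t n t>0 large = ≤-trans (begin
    8 * (r * r * (r * ρ)) * (2 ^ M * M)                ≤⟨ *-mono-≤ (*-monoʳ-≤ 8 r⁶≤) (*-monoʳ-≤ (2 ^ M) (n≤2^n M)) ⟩
    2 ^ 3 * 2 ^ (r * 6) * (2 ^ M * 2 ^ M)              ≡⟨ cong₂ _*_ (^-distribˡ-+-* 2 3 (r * 6)) (^-distribˡ-+-* 2 M M) ⟨
    2 ^ (3 + r * 6) * 2 ^ (M + M)                      ≡⟨ ^-distribˡ-+-* 2 (3 + r * 6) (M + M) ⟨
    2 ^ (3 + r * 6 + (M + M))                          ≤⟨ ^-monoʳ-≤ 2 exponent ⟩
    2 ^ (t * r ^ ((r + 7) * (r + 1)))                  ∎) large
    where
    open ≤-Reasoning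
    r ρ M C : ℕ
    r = suc (suc k)
    ρ = r * r * r
    M = t * (r * (r * ρ)) ^ r
    C = r ^ (r * r + 3 * r + 7)
    r⁶≤ : r * r * (r * ρ) ≤ 2 ^ (r * 6)
    r⁶≤ = begin
      r * r * (r * ρ)  ≡⟨ e r ⟩
      r ^ 6            ≤⟨ ^-monoˡ-≤ 6 (n≤2^n r) ⟩
      (2 ^ r) ^ 6      ≡⟨ ^-*-assoc 2 r 6 ⟩
      2 ^ (r * 6)      ∎
      where
      e : ∀ r → r * r * (r * (r * r * r)) ≡ r * (r * (r * (r * (r * (r * 1)))))
      e = solve-∀
    instance
      M≢0 : NonZero M
      M≢0 = m*n≢0 t _ {{>-nonZero t>0}} {{m^n≢0 (r * (r * ρ)) r}}
    2≤r : 2 ≤ r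
    2≤r = s≤s (s≤s z≤n)
    C≥ : 5 + r * 6 ≤ C
    C≥ = begin
      -- The number 58 is `2 ^ 6 - 6`, chosen so that the sum becomes `r * 2 ^ 6`.
      5 + r * 6                     ≤⟨ +-monoˡ-≤ (r * 6) (*-mono-≤ {1} {r} {5} {58} (s≤s z≤n) (m≤m+n 5 53)) ⟩
      r * 58 + r * 6                ≡⟨ *-distribˡ-+ r 58 6 ⟨
      r * 2 ^ 6                     ≤⟨ *-monoʳ-≤ r (^-monoˡ-≤ 6 2≤r) ⟩
      r ^ 7                         ≤⟨ ^-monoʳ-≤ r (m≤n+m 7 (r * r + 3 * r)) ⟩
      C                             ∎
    exponent : 3 + r * 6 + (M + M) ≤ t * r ^ ((r + 7) * (r + 1))
    exponent = begin
      3 + r * 6 + (M + M)                                ≤⟨ +-monoˡ-≤ (M + M) (m≤n*m (3 + r * 6) M) ⟩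
      M * (3 + r * 6) + (M + M)                          ≡⟨ e₁ M (r * 6) ⟩
      M * (5 + r * 6)                                    ≤⟨ *-monoʳ-≤ M C≥ ⟩
      t * (r * (r * ρ)) ^ r * C                          ≡⟨ cong (λ x → t * x ^ r * C) (e₂ r) ⟩
      t * (r ^ 5) ^ r * C                                ≡⟨ cong (λ x → t * x * C) (^-*-assoc r 5 r) ⟩
      t * r ^ (5 * r) * C                                ≡⟨ *-assoc t (r ^ (5 * r)) C ⟩
      t * (r ^ (5 * r) * C)                              ≡⟨ cong (t *_) (^-distribˡ-+-* r (5 * r) (r * r + 3 * r + 7)) ⟨
      t * r ^ (5 * r + (r * r + 3 * r + 7))              ≡⟨ cong (λ x → t * r ^ x) (e₃ r) ⟩
      t * r ^ ((r + 7) * (r + 1))                        ∎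
      where
      e₁ : ∀ M x → M * (3 + x) + (M + M) ≡ M * (5 + x)
      e₁ = solve-∀
      e₂ : ∀ r → r * (r * (r * r * r)) ≡ r * (r * (r * (r * (r * 1))))
      e₂ = solve-∀
      e₃ : ∀ r → 5 * r + (r * r + 3 * r + 7) ≡ (r + 7) * (r + 1)
      e₃ = solve-∀

-- Passing between rational hypotheses and natural-number inequalities.

module Rationals where
  open import Data.Nat as ℕ using (ℕ; zero; suc; NonZero; _!)
  import Data.Nat.Properties as ℕ
  open import Data.Integer as ℤ using (+_)
  import Data.Integer.Properties as ℤ
  open import Data.Integer.DivMod using ([n/d]*d≤n)
  open import Data.Rational hiding (NonZero; ≢-nonZero; >-nonZero; <-nonZero)
  open import Data.Rational.Properties
  open import Data.Rational.Solver using (module +-*-Solver)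
  open +-*-Solver using (solve; _:=_; _:+_; _:*_; _:-_; con)
  import Data.Rational.Unnormalised as ℚᵘ
  import Data.Rational.Unnormalised.Properties as ℚᵘ
  open import Data.Product using (_×_; _,_; ∃-syntax)
  open import Data.Sum using (inj₁; inj₂)
  open import Relation.Binary.PropositionalEquality as ≡ using (_≡_; refl; cong; cong₂; subst; subst₂; trans)
  open import Relation.Nullary using (yes; no)

  ι : ℕ → ℚ
  ι = ℕtoℚ

  toℚᵘ-/ : ∀ z d .{{_ : NonZero d}} → toℚᵘ (z / d) ℚᵘ.≃ (z ℚᵘ./ d)
  toℚᵘ-/ z (suc d) = toℚᵘ-fromℚᵘ (ℚᵘ.mkℚᵘ z d)

  /-cancel : ∀ x d .{{_ : NonZero d}} → ((+ x) / d) * ι d ≡ ι x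
  /-cancel x (suc d) = toℚᵘ-injective (begin
    toℚᵘ (((+ x) / suc d) * ι (suc d))                ≈⟨ toℚᵘ-homo-* ((+ x) / suc d) (ι (suc d)) ⟩
    toℚᵘ ((+ x) / suc d) ℚᵘ.* toℚᵘ (ι (suc d))        ≈⟨ ℚᵘ.*-cong (toℚᵘ-/ (+ x) (suc d)) (toℚᵘ-/ (+ suc d) 1) ⟩
    ((+ x) ℚᵘ./ suc d) ℚᵘ.* ((+ suc d) ℚᵘ./ 1)        ≈⟨ ℚᵘ.*≡* (trans (ℤ.*-identityʳ _) (cong (λ y → + x ℤ.* + y) (≡.sym (ℕ.*-identityʳ (suc d))))) ⟩
    (+ x) ℚᵘ./ 1                                      ≈⟨ toℚᵘ-/ (+ x) 1 ⟨
    toℚᵘ (ι x)                                        ∎)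
    where open ℚᵘ.≃-Reasoning

  ι-+ : ∀ x y → ι (x ℕ.+ y) ≡ ι x + ι y
  ι-+ x y = toℚᵘ-injective (begin
    toℚᵘ (ι (x ℕ.+ y))                    ≈⟨ toℚᵘ-/ (+ (x ℕ.+ y)) 1 ⟩
    (+ (x ℕ.+ y)) ℚᵘ./ 1                  ≈⟨ ℚᵘ.*≡* (cong (ℤ._* + 1) (≡.sym (cong₂ ℤ._+_ (ℤ.*-identityʳ (+ x)) (ℤ.*-identityʳ (+ y))))) ⟩
    ((+ x) ℚᵘ./ 1) ℚᵘ.+ ((+ y) ℚᵘ./ 1)    ≈⟨ ℚᵘ.+-cong (toℚᵘ-/ (+ x) 1) (toℚᵘ-/ (+ y) 1) ⟨
    toℚᵘ (ι x) ℚᵘ.+ toℚᵘ (ι y)            ≈⟨ toℚᵘ-homo-+ (ι x) (ι y) ⟨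
    toℚᵘ (ι x + ι y)                      ∎)
    where open ℚᵘ.≃-Reasoning

  ι-* : ∀ x y → ι (x ℕ.* y) ≡ ι x * ι y
  ι-* x y = toℚᵘ-injective (begin
    toℚᵘ (ι (x ℕ.* y))                    ≈⟨ toℚᵘ-/ (+ (x ℕ.* y)) 1 ⟩
    (+ (x ℕ.* y)) ℚᵘ./ 1                  ≈⟨ ℚᵘ.*≡* (cong (ℤ._* + 1) (ℤ.pos-* x y)) ⟩
    ((+ x) ℚᵘ./ 1) ℚᵘ.* ((+ y) ℚᵘ./ 1)    ≈⟨ ℚᵘ.*-cong (toℚᵘ-/ (+ x) 1) (toℚᵘ-/ (+ y) 1) ⟨
    toℚᵘ (ι x) ℚᵘ.* toℚᵘ (ι y)            ≈⟨ toℚᵘ-homo-* (ι x) (ι y) ⟨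
    toℚᵘ (ι x * ι y)                      ∎)
    where open ℚᵘ.≃-Reasoning

  /1-mono-≤ : ∀ {y z} → y ℤ.≤ z → y / 1 ≤ z / 1
  /1-mono-≤ {y} {z} y≤z = toℚᵘ-cancel-≤ (begin
    toℚᵘ (y / 1)   ≃⟨ toℚᵘ-/ y 1 ⟩
    y ℚᵘ./ 1       ≤⟨ ℚᵘ.*≤* (ℤ.*-monoʳ-≤-nonNeg (+ 1) y≤z) ⟩
    z ℚᵘ./ 1       ≃⟨ toℚᵘ-/ z 1 ⟨
    toℚᵘ (z / 1)   ∎)
    where open ℚᵘ.≤-Reasoning

  ι-mono-≤ : ∀ {x y} → x ℕ.≤ y → ι x ≤ ι y
  ι-mono-≤ x≤y = /1-mono-≤ (ℤ.+≤+ x≤y)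

  ι-injective : ∀ {x y} → ι x ≡ ι y → x ≡ y
  ι-injective {x} {y} e with ℚᵘ.*≡* e′ ← ℚᵘ.≃-trans (ℚᵘ.≃-sym (toℚᵘ-/ (+ x) 1)) (ℚᵘ.≃-trans (ℚᵘ.≃-reflexive (cong toℚᵘ e)) (toℚᵘ-/ (+ y) 1))
    = ℤ.+-injective (trans (≡.sym (ℤ.*-identityʳ (+ x))) (trans e′ (ℤ.*-identityʳ (+ y))))

  ι-cancel-≤ : ∀ {x y} → ι x ≤ ι y → x ℕ.≤ y
  ι-cancel-≤ {x} {y} le = ℕ.≮⇒≥ λ y<x → ℕ.<-irrefl (ι-injective (≤-antisym (ι-mono-≤ (ℕ.<⇒≤ y<x)) le)) y<x

  ι-cancel-< : ∀ {x y} → ι x < ι y → x ℕ.< y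
  ι-cancel-< lt = ℕ.≰⇒> λ y≤x → <-irrefl refl (<-≤-trans lt (ι-mono-≤ y≤x))

  ι-mono-< : ∀ {x y} → x ℕ.< y → ι x < ι y
  ι-mono-< x<y = ≰⇒> λ le → ℕ.<⇒≱ x<y (ι-cancel-≤ le)

  ι-nonNeg : ∀ x → NonNegative (ι x)
  ι-nonNeg x = nonNegative (ι-mono-≤ {0} {x} ℕ.z≤n)

  ι-pos : ∀ x .{{_ : NonZero x}} → Positive (ι x)
  ι-pos x = positive (ι-mono-< (ℕ.>-nonZero⁻¹ x))

  -- The ceiling is the negated floor of `- x`, so this reduces to the inequality that defines
  -- integer division.
  ceiling-upper : ∀ x e → + e ≡ ceiling x → x ≤ ι e
  ceiling-upper x@record{} e eq = subst₂ _≤_ (neg-involutive x) (neg-involutive (ι e)) (neg-antimono-≤ -e≤-x)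
    where
    neg-involutive : ∀ q → - - q ≡ q
    neg-involutive q = solve 1 (λ q → +-*-Solver.:- (+-*-Solver.:- q) := q) refl q
    floor≤ : floor (- x) / 1 ≤ - x
    floor≤ = go (- x)
      where
      open ℚᵘ.≤-Reasoning
      go : ∀ y → floor y / 1 ≤ y
      go y@record{} = toℚᵘ-cancel-≤ (begin
        toℚᵘ (floor y / 1)   ≃⟨ toℚᵘ-/ (floor y) 1 ⟩
        floor y ℚᵘ./ 1       ≤⟨ ℚᵘ.*≤* (ℤ.≤-trans ([n/d]*d≤n (↥ y) (↧ y)) (ℤ.≤-reflexive (≡.sym (ℤ.*-identityʳ (↥ y))))) ⟩
        toℚᵘ y               ∎)
    neg-/1 : (ℤ.- (+ e)) / 1 ≡ - ι e
    neg-/1 = toℚᵘ-injective (begin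
      toℚᵘ ((ℤ.- (+ e)) / 1)       ≈⟨ toℚᵘ-/ (ℤ.- (+ e)) 1 ⟩
      ℚᵘ.- ((+ e) ℚᵘ./ 1)          ≈⟨ ℚᵘ.-‿cong (toℚᵘ-/ (+ e) 1) ⟨
      ℚᵘ.- toℚᵘ (ι e)              ≈⟨ toℚᵘ-homo‿- (ι e) ⟨
      toℚᵘ (- ι e)                 ∎)
      where open ℚᵘ.≃-Reasoning
    -e≤-x : - ι e ≤ - x
    -e≤-x = subst (_≤ - x) neg-/1 (subst (λ z → z / 1 ≤ - x)
      (trans (≡.sym (ℤ.neg-involutive (floor (- x)))) (cong ℤ.-_ (≡.sym eq))) floor≤)

  /-mono-≤ : ∀ d .{{_ : NonZero d}} {x y} → x ℕ.≤ y → (+ x) / d ≤ (+ y) / d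
  /-mono-≤ d {x} {y} x≤y = *-cancelʳ-≤-pos (ι d) {{ι-pos d}}
    (subst₂ _≤_ (≡.sym (/-cancel x d)) (≡.sym (/-cancel y d)) (ι-mono-≤ x≤y))

  /-≤-ι : ∀ x d y .{{_ : NonZero d}} → (+ x) / d ≤ ι y → x ℕ.≤ y ℕ.* d
  /-≤-ι x d y le = ι-cancel-≤ (subst₂ _≤_ (/-cancel x d) (≡.sym (ι-* y d)) (*-monoʳ-≤-nonNeg (ι d) {{ι-nonNeg d}} le))

  expPartial-mono : ∀ {m m′} → m ℕ.≤ m′ → ∀ k → expPartial m k ≤ expPartial m′ k
  expPartial-mono m≤m′ zero    = ≤-refl
  expPartial-mono m≤m′ (suc k) = +-mono-≤ (expPartial-mono m≤m′ k)
    (/-mono-≤ (k !) {{k ℕ.!≢0}} (ℕ.^-monoˡ-≤ k m≤m′))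

  ExpLe-anti : ∀ {m m′ x} → m ℕ.≤ m′ → ExpLe m′ x → ExpLe m x
  ExpLe-anti m≤m′ h k = ≤-trans (expPartial-mono m≤m′ k) (h k)

  0≤expPartial : ∀ m k → 0ℚ ≤ expPartial m k
  0≤expPartial m zero    = ≤-refl
  0≤expPartial m (suc k) = +-mono-≤ {0ℚ} {_} {0ℚ} (0≤expPartial m k)
    (*-cancelʳ-≤-pos (ι (k !)) {{ι-pos (k !) {{k ℕ.!≢0}}}}
      (subst₂ _≤_ (≡.sym (*-zeroˡ (ι (k !)))) (≡.sym (/-cancel (m ℕ.^ k) (k !) {{k ℕ.!≢0}})) (ι-mono-≤ {0} {m ℕ.^ k} ℕ.z≤n)))

  ExpLe-term : ∀ m x k → ExpLe m x → m ℕ.^ k ℕ.≤ x ℕ.* k !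
  ExpLe-term m x k h = /-≤-ι (m ℕ.^ k) (k !) x {{k ℕ.!≢0}}
    (≤-trans (≤-trans (≤-reflexive (≡.sym (+-identityˡ term))) (+-monoˡ-≤ term (0≤expPartial m k))) (h (suc k)))
    where
    term : ℚ
    term = ((+ (m ℕ.^ k)) / (k !)) {{k ℕ.!≢0}}

  positive-fraction : ∀ α → 0ℚ < α → ∃[ a ] ∃[ b ] (0 ℕ.< a × 0 ℕ.< b × α * ι b ≡ ι a)
  positive-fraction α 0<α with α | positive 0<α
  ... | q@(mkℚ (+ suc a) b-1 _) | _ = suc a , suc b-1 , ℕ.z<s , ℕ.z<s ,
    trans (cong (_* ι (suc b-1)) (≡.sym (↥p/↧p≡p q))) (/-cancel (suc a) (suc b-1))

  inv-cancel : ∀ m .{{_ : NonZero m}} → inv m * ι m ≡ 1ℚ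
  inv-cancel (suc m) = /-cancel 1 (suc m)

  module _ (α : ℚ) (a b : ℕ) (αb≡a : α * ι b ≡ ι a) where

    α-upper : ∀ x .{{_ : NonZero x}} y .{{_ : NonZero y}} → 0 ℕ.< b → α < inv x * inv y → x ℕ.* y ℕ.* a ℕ.< b
    α-upper x y b>0 lt = ι-cancel-< (subst₂ _<_ lhs rhs
      (*-monoˡ-<-pos (ι (b ℕ.* (x ℕ.* y))) {{ι-pos (b ℕ.* (x ℕ.* y)) {{ℕ.m*n≢0 b (x ℕ.* y) {{ℕ.>-nonZero b>0}} {{ℕ.m*n≢0 x y}}}}}} lt))
      where
      open ≡.≡-Reasoning
      expand : ι (b ℕ.* (x ℕ.* y)) ≡ ι b * (ι x * ι y)
      expand = trans (ι-* b (x ℕ.* y)) (cong (ι b *_) (ι-* x y))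
      lhs : α * ι (b ℕ.* (x ℕ.* y)) ≡ ι (x ℕ.* y ℕ.* a)
      lhs = begin
        α * ι (b ℕ.* (x ℕ.* y))      ≡⟨ cong (α *_) expand ⟩
        α * (ι b * (ι x * ι y))      ≡⟨ solve 4 (λ α b x y → α :* (b :* (x :* y)) := x :* y :* (α :* b)) refl α (ι b) (ι x) (ι y) ⟩
        ι x * ι y * (α * ι b)        ≡⟨ cong₂ _*_ (≡.sym (ι-* x y)) αb≡a ⟩
        ι (x ℕ.* y) * ι a            ≡⟨ ι-* (x ℕ.* y) a ⟨
        ι (x ℕ.* y ℕ.* a)            ∎
      rhs : inv x * inv y * ι (b ℕ.* (x ℕ.* y)) ≡ ι b
      rhs = begin
        inv x * inv y * ι (b ℕ.* (x ℕ.* y))       ≡⟨ cong (inv x * inv y *_) expand ⟩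
        inv x * inv y * (ι b * (ι x * ι y))       ≡⟨ solve 5 (λ u v b x y → u :* v :* (b :* (x :* y)) := (u :* x) :* (v :* y) :* b) refl (inv x) (inv y) (ι b) (ι x) (ι y) ⟩
        (inv x * ι x) * (inv y * ι y) * ι b       ≡⟨ cong₂ (λ u v → u * v * ι b) (inv-cancel x) (inv-cancel y) ⟩
        1ℚ * 1ℚ * ι b                             ≡⟨ *-identityˡ (ι b) ⟩
        ι b                                       ∎

    -- Multiplication by `2 * b * r` clears ½, α and 1/r at once; the α term then moves to the other
    -- side as `a * r * n²`.
    edges-lower : ∀ p n e → let r = suc p in (1ℚ - inv r - α) * ι n * ι n * ½ ≤ ι e →
      b ℕ.* (p ℕ.* (n ℕ.* n)) ℕ.≤ b ℕ.* (r ℕ.* (2 ℕ.* e)) ℕ.+ a ℕ.* (r ℕ.* (n ℕ.* n))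
    edges-lower p n e le = ι-cancel-≤ (subst₂ _≤_ lhs rhs (+-monoˡ-≤ (ι a * (ι r * (ι n * ι n)))
      (*-monoʳ-≤-nonNeg (ι (2 ℕ.* b ℕ.* r)) {{ι-nonNeg (2 ℕ.* b ℕ.* r)}} le)))
      where
      open ≡.≡-Reasoning
      r : ℕ
      r = suc p
      nn : ι (n ℕ.* n) ≡ ι n * ι n
      nn = ι-* n n
      arnn : ι (a ℕ.* (r ℕ.* (n ℕ.* n))) ≡ ι a * (ι r * (ι n * ι n))
      arnn = trans (ι-* a (r ℕ.* (n ℕ.* n))) (cong (ι a *_) (trans (ι-* r (n ℕ.* n)) (cong (ι r *_) nn)))
      2br : ι (2 ℕ.* b ℕ.* r) ≡ ι 2 * ι b * ι r
      2br = trans (ι-* (2 ℕ.* b) r) (cong (_* ι r) (ι-* 2 b))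
      lhs : (1ℚ - inv r - α) * ι n * ι n * ½ * ι (2 ℕ.* b ℕ.* r) + ι a * (ι r * (ι n * ι n)) ≡ ι (b ℕ.* (p ℕ.* (n ℕ.* n)))
      lhs = begin
        (1ℚ - inv r - α) * ι n * ι n * ½ * ι (2 ℕ.* b ℕ.* r) + ι a * (ι r * (ι n * ι n))
          ≡⟨ cong₂ (λ u v → (1ℚ - inv r - α) * ι n * ι n * ½ * u + v * (ι r * (ι n * ι n))) 2br (≡.sym αb≡a) ⟩
        (1ℚ - inv r - α) * ι n * ι n * ½ * (ι 2 * ι b * ι r) + α * ι b * (ι r * (ι n * ι n))
          ≡⟨ solve 5 (λ s α n b r → (con 1ℚ :- s :- α) :* n :* n :* con ½ :* (con (ι 2) :* b :* r) :+ α :* b :* (r :* (n :* n))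
                       := b :* ((r :- s :* r) :* (n :* n))) refl (inv r) α (ι n) (ι b) (ι r) ⟩
        ι b * ((ι r - inv r * ι r) * (ι n * ι n))
          ≡⟨ cong₂ (λ u v → ι b * ((u - v) * (ι n * ι n))) (ι-+ 1 p) (inv-cancel r) ⟩
        ι b * ((1ℚ + ι p - 1ℚ) * (ι n * ι n))
          ≡⟨ solve 3 (λ b p x → b :* ((con 1ℚ :+ p :- con 1ℚ) :* x) := b :* (p :* x)) refl (ι b) (ι p) (ι n * ι n) ⟩
        ι b * (ι p * (ι n * ι n))
          ≡⟨ trans (ι-* b (p ℕ.* (n ℕ.* n))) (cong (ι b *_) (trans (ι-* p (n ℕ.* n)) (cong (ι p *_) nn))) ⟨
        ι (b ℕ.* (p ℕ.* (n ℕ.* n))) ∎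
      rhs : ι e * ι (2 ℕ.* b ℕ.* r) + ι a * (ι r * (ι n * ι n)) ≡ ι (b ℕ.* (r ℕ.* (2 ℕ.* e)) ℕ.+ a ℕ.* (r ℕ.* (n ℕ.* n)))
      rhs = begin
        ι e * ι (2 ℕ.* b ℕ.* r) + ι a * (ι r * (ι n * ι n))
          ≡⟨ cong₂ (λ u v → ι e * u + v) 2br (≡.sym arnn) ⟩
        ι e * (ι 2 * ι b * ι r) + ι (a ℕ.* (r ℕ.* (n ℕ.* n)))
          ≡⟨ cong (_+ ι (a ℕ.* (r ℕ.* (n ℕ.* n)))) (solve 4 (λ e t b r → e :* (t :* b :* r) := b :* (r :* (t :* e))) refl (ι e) (ι 2) (ι b) (ι r)) ⟩
        ι b * (ι r * (ι 2 * ι e)) + ι (a ℕ.* (r ℕ.* (n ℕ.* n)))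
          ≡⟨ cong (_+ ι (a ℕ.* (r ℕ.* (n ℕ.* n)))) (trans (ι-* b (r ℕ.* (2 ℕ.* e))) (cong (ι b *_) (trans (ι-* r (2 ℕ.* e)) (cong (ι r *_) (ι-* 2 e))))) ⟨
        ι (b ℕ.* (r ℕ.* (2 ℕ.* e))) + ι (a ℕ.* (r ℕ.* (n ℕ.* n)))
          ≡⟨ ι-+ (b ℕ.* (r ℕ.* (2 ℕ.* e))) (a ℕ.* (r ℕ.* (n ℕ.* n))) ⟨
        ι (b ℕ.* (r ℕ.* (2 ℕ.* e)) ℕ.+ a ℕ.* (r ℕ.* (n ℕ.* n))) ∎

    scaled : ∀ c n → ι c * α * ι n * ι n * ι b ≡ ι (c ℕ.* a ℕ.* (n ℕ.* n))
    scaled c n = begin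
      ι c * α * ι n * ι n * ι b          ≡⟨ solve 4 (λ c α n b → c :* α :* n :* n :* b := c :* (α :* b) :* (n :* n)) refl (ι c) α (ι n) (ι b) ⟩
      ι c * (α * ι b) * (ι n * ι n)      ≡⟨ cong₂ (λ u v → ι c * u * v) αb≡a (≡.sym (ι-* n n)) ⟩
      ι c * ι a * ι (n ℕ.* n)            ≡⟨ cong (_* ι (n ℕ.* n)) (ι-* c a) ⟨
      ι (c ℕ.* a) * ι (n ℕ.* n)          ≡⟨ ι-* (c ℕ.* a) (n ℕ.* n) ⟨
      ι (c ℕ.* a ℕ.* (n ℕ.* n))          ∎
      where open ≡.≡-Reasoning

    square-mono-≤ : ∀ {x y} → 0ℚ ≤ x → x ≤ y → x * x ≤ y * y
    square-mono-≤ {x} {y} 0≤x x≤y = ≤-trans (*-monoʳ-≤-nonNeg x {{nonNegative 0≤x}} x≤y)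
      (*-monoˡ-≤-nonNeg y {{nonNegative (≤-trans 0≤x x≤y)}} x≤y)

    leSqrt : ∀ n s j → 0 ℕ.< b → n ℕ.≤ s ℕ.+ j → b ℕ.* (j ℕ.* j) ℕ.≤ 2 ℕ.* a ℕ.* (n ℕ.* n) →
      LeSqrt (ι n - ι s) (ι 2 * α * ι n * ι n)
    leSqrt n s j b>0 n≤ j≤ with ≤-total (ι n - ι s) 0ℚ
    ... | inj₁ D≤0 = inj₁ D≤0
    ... | inj₂ 0≤D = inj₂ (≤-trans (square-mono-≤ 0≤D D≤j)
      (*-cancelʳ-≤-pos (ι b) {{ι-pos b {{ℕ.>-nonZero b>0}}}} (subst₂ _≤_ lhs (≡.sym (scaled 2 n)) (ι-mono-≤ j≤))))
      where
      D≤j : ι n - ι s ≤ ι j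
      D≤j = ≤-trans (+-monoˡ-≤ (- ι s) (≤-trans (ι-mono-≤ n≤) (≤-reflexive (ι-+ s j))))
        (≤-reflexive (solve 2 (λ s j → s :+ j :- s := j) refl (ι s) (ι j)))
      lhs : ι (b ℕ.* (j ℕ.* j)) ≡ ι j * ι j * ι b
      lhs = trans (ι-* b (j ℕ.* j)) (trans (*-comm (ι b) _) (cong (_* ι b) (ι-* j j)))

    -- A negative difference is covered by the first alternative. Otherwise `r` times the difference
    -- lies between 0 and `z`, so it may be squared, and the comparison is made after scaling by
    -- `r² * b`.
    ltSqrt : ∀ p n d z → let r = suc p in p ℕ.* n ℕ.≤ r ℕ.* d ℕ.+ z →
      b ℕ.* (z ℕ.* z) ℕ.< 8 ℕ.* a ℕ.* (r ℕ.* r) ℕ.* (n ℕ.* n) →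
      LtSqrt ((1ℚ - inv r) * ι n - ι d) (ι 8 * α * ι n * ι n)
    ltSqrt p n d z pn≤ z< with (1ℚ - inv (suc p)) * ι n - ι d <? 0ℚ
    ... | yes D<0 = inj₁ D<0
    ... | no  D≮0 = inj₂ (*-cancelʳ-<-nonNeg (ι r * ι r * ι b) {{rrb≥0}} (begin-strict
      D * D * (ι r * ι r * ι b)                      ≡⟨ solve 3 (λ D r b → D :* D :* (r :* r :* b) := (D :* r) :* (D :* r) :* b) refl D (ι r) (ι b) ⟩
      (D * ι r) * (D * ι r) * ι b                    ≤⟨ *-monoʳ-≤-nonNeg (ι b) {{ι-nonNeg b}} (square-mono-≤ 0≤Dr Dr≤z) ⟩
      ι z * ι z * ι b                                ≡⟨ trans (cong (_* ι b) (≡.sym (ι-* z z))) (trans (*-comm _ (ι b)) (≡.sym (ι-* b (z ℕ.* z)))) ⟩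
      ι (b ℕ.* (z ℕ.* z))                            <⟨ ι-mono-< z< ⟩
      ι (8 ℕ.* a ℕ.* (r ℕ.* r) ℕ.* (n ℕ.* n))        ≡⟨ cong ι (reorder a (r ℕ.* r) (n ℕ.* n)) ⟩
      ι (8 ℕ.* a ℕ.* (n ℕ.* n) ℕ.* (r ℕ.* r))        ≡⟨ trans (ι-* (8 ℕ.* a ℕ.* (n ℕ.* n)) (r ℕ.* r)) (cong₂ _*_ (≡.sym (scaled 8 n)) (ι-* r r)) ⟩
      Y * ι b * (ι r * ι r)                          ≡⟨ solve 3 (λ y b r → y :* b :* (r :* r) := y :* (r :* r :* b)) refl Y (ι b) (ι r) ⟩
      Y * (ι r * ι r * ι b)                          ∎))
      where
      open ≤-Reasoning
      r : ℕ
      r = suc p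
      D Y : ℚ
      D = (1ℚ - inv r) * ι n - ι d
      Y = ι 8 * α * ι n * ι n
      reorder : ∀ a x y → 8 ℕ.* a ℕ.* x ℕ.* y ≡ 8 ℕ.* a ℕ.* y ℕ.* x
      reorder a x y = trans (ℕ.*-assoc (8 ℕ.* a) x y) (trans (cong (8 ℕ.* a ℕ.*_) (ℕ.*-comm x y)) (≡.sym (ℕ.*-assoc (8 ℕ.* a) y x)))
      rrb≥0 : NonNegative (ι r * ι r * ι b)
      rrb≥0 = subst NonNegative (trans (ι-* (r ℕ.* r) b) (cong (_* ι b) (ι-* r r))) (ι-nonNeg (r ℕ.* r ℕ.* b))
      0≤Dr : 0ℚ ≤ D * ι r
      0≤Dr = ≤-trans (≤-reflexive (≡.sym (*-zeroˡ (ι r)))) (*-monoʳ-≤-nonNeg (ι r) {{ι-nonNeg r}} (≮⇒≥ D≮0))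
      Dr≤z : D * ι r ≤ ι z
      Dr≤z = begin
        D * ι r                                       ≡⟨ solve 4 (λ s n d r → ((con 1ℚ :- s) :* n :- d) :* r := (r :- s :* r) :* n :- r :* d) refl (inv r) (ι n) (ι d) (ι r) ⟩
        (ι r - inv r * ι r) * ι n - ι r * ι d         ≡⟨ cong₂ (λ u v → (u - v) * ι n - ι r * ι d) (ι-+ 1 p) (inv-cancel r) ⟩
        (1ℚ + ι p - 1ℚ) * ι n - ι r * ι d             ≡⟨ cong (_- ι r * ι d) (solve 2 (λ p n → (con 1ℚ :+ p :- con 1ℚ) :* n := p :* n) refl (ι p) (ι n)) ⟩
        ι p * ι n - ι r * ι d                         ≡⟨ cong (_- ι r * ι d) (ι-* p n) ⟨
        ι (p ℕ.* n) - ι r * ι d                       ≤⟨ +-monoˡ-≤ (- (ι r * ι d)) (ι-mono-≤ pn≤) ⟩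
        ι (r ℕ.* d ℕ.+ z) - ι r * ι d                 ≡⟨ cong (_- ι r * ι d) (trans (ι-+ (r ℕ.* d) z) (cong (_+ ι z) (ι-* r d))) ⟩
        ι r * ι d + ι z - ι r * ι d                   ≡⟨ solve 2 (λ x z → x :+ z :- x := z) refl (ι r * ι d) (ι z) ⟩
        ι z                                           ∎

open import Data.Nat using (ℕ; _≤_)
open import Data.Integer using (+_)
open import Data.Rational using (ℚ; _+_; _*_; _-_; _<_; 0ℚ; 1ℚ; ceiling; ½)
open import Data.Sum using (_⊎_)
open import Data.Product using (Σ; _×_)
open import Relation.Binary.PropositionalEquality using (_≡_)

open import Data.Nat using (zero; suc; s≤s; z≤n) renaming (_+_ to _ℕ+_; _*_ to _ℕ*_; _<_ to _ℕ<_)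
open import Data.Product using (_,_)
open import Data.Sum using (inj₁; inj₂)
open import Function using (case_of_)
open import Relation.Binary.PropositionalEquality using (refl; subst) renaming (sym to ≡-sym)
open import Relation.Nullary using (contradiction)
import Data.Nat.Properties as ℕ
import Data.Nat.Tactic.RingSolver as ℕ
open Combinatorics
open Rationals

theorem4 : (r : ℕ) → 2 ≤ r →
    (α : ℚ) → 0ℚ < α → α < inv 8 * inv (r Data.Nat.^ 8) →
    (n : ℕ) → ExpLe (2 Data.Nat.* invC r) n →
    (G : Graph n) →
    + edgeCount G ≡ ceiling ((1ℚ - inv r - α) * ℕtoℚ n * ℕtoℚ n * ½) →
    (t : ℕ) → IsFloorCLn r n t →
    ContainsKrPlus G r t
    ⊎ Σ (VSet n) (λ S →
        InducedRPartite G S r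
        × LeSqrt (ℕtoℚ n - ℕtoℚ (card S)) (ℕtoℚ 2 * α * ℕtoℚ n * ℕtoℚ n)
        × MinDegGtMinusSqrt G S ((1ℚ - inv r) * ℕtoℚ n) (ℕtoℚ 8 * α * ℕtoℚ n * ℕtoℚ n))
-- For `t` equal to 0 or 1 the floor would be below 2, against n ≥ e^(2/c). So `t ≥ 2`, and a part
-- has room for both ends of the extra edge.
theorem4 r@(suc (suc k)) (s≤s (s≤s z≤n)) α 0<α α< n n-large G edges zero (_ , n-small) =
  contradiction (ExpLe-anti {1 ℕ* invC r} {2 ℕ* invC r} {n} (ℕ.*-monoˡ-≤ (invC r) {1} {2} (s≤s z≤n)) n-large) n-small
theorem4 r@(suc (suc k)) (s≤s (s≤s z≤n)) α 0<α α< n n-large G edges (suc zero) (_ , n-small) =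
  contradiction n-large n-small
theorem4 r@(suc (suc k)) (s≤s (s≤s z≤n)) α 0<α α< n n-large G edges t@(suc (suc t′)) (t-small , _) =
  case positive-fraction α 0<α of λ (a , b , a>0 , b>0 , αb≡a) →
  let open Stability G k ρ t′ refl enough a b a>0 in
  case stability
         (subst (λ x → 8 ℕ* x ℕ* a ℕ< b) (r⁸ r) (α-upper α a b αb≡a 8 (r Data.Nat.^ 8) {{ℕ.m^n≢0 r 8}} b>0 α<))
         (subst (λ x → b ℕ* (suc k ℕ* (n ℕ* n)) ≤ b ℕ* (r ℕ* x) ℕ+ a ℕ* (r ℕ* (n ℕ* n))) (≡-sym (handshake G))
           (edges-lower α a b αb≡a (suc k) n (edgeCount G) (ceiling-upper _ (edgeCount G) edges))) of λ where
    (inj₁ found) → inj₁ found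
    (inj₂ (S , st)) →
      case Stable.deleted st of λ (j , n≤ , j≤) →
      inj₂ (S , Stable.partite st ,
        leSqrt α a b αb≡a n (card S) j b>0 (subst (λ x → n ≤ x ℕ+ j) (≡-sym (card≡# S)) n≤) j≤ ,
        λ v v∈ → case Stable.minDegree st v v∈ of λ (z , pn≤ , z<) →
          ltSqrt α a b αb≡a (suc k) n (degIn G S v) z
            (subst (λ x → suc k ℕ* n ≤ r ℕ* x ℕ+ z) (≡-sym (degIn≡deg G S v)) pn≤) z<)
  where
  R ρ : ℕ
  R = r Data.Nat.^ ((r ℕ+ 7) ℕ* (r ℕ+ 1))
  ρ = r ℕ* r ℕ* r
  double : ∀ t x → t ℕ* (2 ℕ* x) ≡ 2 ℕ* (t ℕ* x)
  double = ℕ.solve-∀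
  enough : Extremal.Budget G k ρ refl t
  enough = budget k t n (s≤s z≤n)
    -- Here `t / c = 2 * t * R`, so the term of index `q = t * R` of the series already forces
    -- `n ≥ 2 ^ (t * R)`.
    (2^q≤ (t ℕ* R) n (ExpLe-term (2 ℕ* (t ℕ* R)) n (t ℕ* R) (subst (λ m → ExpLe m n) (double t R) t-small)))
  r⁸ : ∀ r → r ℕ* (r ℕ* (r ℕ* (r ℕ* (r ℕ* (r ℕ* (r ℕ* (r ℕ* 1))))))) ≡ r ℕ* (r ℕ* r ℕ* r) ℕ* (r ℕ* (r ℕ* r ℕ* r))
  r⁸ = ℕ.solve-∀
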